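{- Let $k,n,m\ge1$ be integers and let $\rho=(k^n)=(k,\ldots,k)$ ($n$ parts). Then $$\sum_{\pi\in\mathrm{PP}(k,n,m)}q^{|\pi|_c}=s_\rho(1^n,q,q^2,\ldots,q^m),$$ $$\sum_{\pi\in\mathrm{PP}'(k,n,m)}q^{|\pi|_c}=s_\rho(1^{n-1},q,q^2,\ldots,q^m),$$ $$\sum_{\pi\in\mathrm{PP}(\infty,n,m)}q^{|\pi|_c}=\prod_{i=1}^{m}(1-q^i)^{ -n}.$$
   Context: A plane partition $\pi=(\pi_{ij})_{i,j\ge1}$ is a two-dimensional array of nonnegative integers with finitely many nonzero entries such that $\pi_{ij}\ge\pi_{i+1\,j}$ and $\pi_{ij}\ge\pi_{i\,j+1}$ for all $i,j$ ($i$ is the row index, $j$ the column index). Its shape $\mathrm{sh}(\pi)$ is the partition whose Young diagram is $\{(i,j):\pi_{ij}>0\}$. $\mathrm{PP}(k,n,m)$ is the set of plane partitions with at most $k$ nonzero columns, at most $n$ nonzero rows, and all entries at most $m$; $\mathrm{PP}(\infty,n,m)$ is the same with no restriction on the number of columns. $\mathrm{PP}'(k,n,m)$ is the set of plane partitions whose shape is exactly the rectangle $(k^n)$ ($n$ rows of length $k$, all entries in it positive) and whose entries are at most $m$. With $\mathrm{Des}(\pi)=\{(i,j):\pi_{ij}>\pi_{i+1\,j}\}$, the corner volume is $|\pi|_c=\sum_{(i,j)\in\mathrm{Des}(\pi)}\pi_{ij}$. $s_\rho$ is the Schur polynomial, and $1^r$ denotes $r$ variables set equal to $1$. The third identity is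 between formal power series in $q$. -}

module Defs where

open import Algebra.Bundles.Raw using (RawSemiring; RawRing)
import Algebra.Definitions.RawSemiring as RawSemiringDefs
open import Data.Fin as Fin using (Fin; toℕ)
import Data.Fin.Properties as Fin
open import Data.Integer as ℤ using (ℤ; +_; 0ℤ; 1ℤ)
import Data.Integer.Properties as ℤ
open import Data.List
  using (List; []; _∷_; foldr; map; filter; concat; allFin; upTo;
         cartesianProduct; cartesianProductWith)
open import Data.List.Relation.Binary.Prefix.Heterogeneous using (Prefix)
open import Data.List.Relation.Binary.Prefix.Heterogeneous.Properties using (prefix?)
open import Data.List.Relation.Unary.All as All using (All)
open import Data.List.Relation.Unary.Linked using (Linked; linked?)
open import Data.Nat as ℕ using (ℕ; zero; suc; _≤_; _<_; _≥_; _>_; _∸_)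
import Data.Nat.ListAction as ℕ
import Data.Nat.Properties as ℕ
open import Data.Product using (Σ; ∃; _×_; _,_; proj₁; uncurry)
open import Data.Sum using (_⊎_)
import Data.Vec.Functional as Vector
open Vector using (Vector)
open import Function using (_⇔_; _∘_; _on_)
open import Function.Bundles using (Inverse)
open import Level using (0ℓ)
open import Relation.Binary.Bundles using (Setoid)
open import Relation.Binary.PropositionalEquality
  using (_≡_; refl; sym; trans; cong; cong₂; module ≡-Reasoning)
  renaming (setoid to ≡-setoid)
open import Relation.Nullary.Decidable using (_×-dec_)
open import Relation.Unary using (Pred; Decidable; _∩_)

-- Rows and columns are indexed from 0.
record PlanePartition : Set where
  field
    entry         : ℕ → ℕ → ℕ
    column-decr   : ∀ i j → entry i j ≥ entry (suc i) j
    row-decr      : ∀ i j → entry i j ≥ entry i (suc j)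
    finite        : ∃ λ N → ∀ i j → N ≤ i ⊎ N ≤ j → entry i j ≡ 0

  bound : ℕ
  bound = proj₁ finite

open PlanePartition public

-- Equality of arrays; the chosen bound on the support is irrelevant.
_≗ₚ_ : PlanePartition → PlanePartition → Set
π ≗ₚ σ = ∀ i j → entry π i j ≡ entry σ i j

-- The Young diagram of sh(π).
Shape : PlanePartition → Pred (ℕ × ℕ) 0ℓ
Shape π (i , j) = entry π i j > 0

Des : PlanePartition → Pred (ℕ × ℕ) 0ℓ
Des π (i , j) = entry π i j > entry π (suc i) j

Des? : ∀ π → Decidable (Des π)
Des? π (i , j) = entry π (suc i) j ℕ.<? entry π i j

-- A cell of Des π has a positive entry, so the square of side bound π
-- contains all of Des π, and the value does not depend on the bound.
cornerVolume : PlanePartition → ℕ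
cornerVolume π =
  ℕ.sum (map (uncurry (entry π))
             (filter (Des? π) (cartesianProduct (upTo (bound π)) (upTo (bound π)))))

-- By monotonicity the nonzero rows (columns) are the initial ones, so
-- having at most n of them means that those with index ≥ n vanish.
RowsAtMost ColumnsAtMost EntriesAtMost : ℕ → Pred PlanePartition 0ℓ
RowsAtMost    n π = ∀ i j → n ≤ i → entry π i j ≡ 0
ColumnsAtMost k π = ∀ i j → k ≤ j → entry π i j ≡ 0
EntriesAtMost m π = ∀ i j → entry π i j ≤ m

PP : (k n m : ℕ) → Pred PlanePartition 0ℓ
PP k n m = ColumnsAtMost k ∩ RowsAtMost n ∩ EntriesAtMost m

PP∞ : (n m : ℕ) → Pred PlanePartition 0ℓ
PP∞ n m = RowsAtMost n ∩ EntriesAtMost m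

PP′ : (k n m : ℕ) → Pred PlanePartition 0ℓ
PP′ k n m = (λ π → ∀ i j → Shape π (i , j) ⇔ (i < n × j < k)) ∩ EntriesAtMost m

-- A filling is the list of its rows, from top to bottom.
Filling : ℕ → Set
Filling r = List (List (Fin r))

words : (r l : ℕ) → List (List (Fin r))
words r zero    = [] ∷ []
words r (suc l) = cartesianProductWith _∷_ (allFin r) (words r l)

-- All fillings of the Young diagram with the given row lengths, without
-- repetition.
fillings : (r : ℕ) → List ℕ → List (Filling r)
fillings r []      = [] ∷ []
fillings r (l ∷ ρ) = cartesianProductWith _∷_ (words r l) (fillings r ρ)

-- The row below is at most as long, and its entries are strictly larger
-- than those directly above.
_Above_ : ∀ {r} → List (Fin r) → List (Fin r) → Set
upper Above lower = Prefix Fin._>_ lower upper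

Semistandard : ∀ {r} → Pred (Filling r) 0ℓ
Semistandard T = All (Linked Fin._≤_) T × Linked _Above_ T

semistandard? : ∀ {r} → Decidable (Semistandard {r})
semistandard? T =
  All.all? (linked? Fin._≤?_) T
    ×-dec linked? (λ upper lower → prefix? (λ a b → b Fin.<? a) lower upper) T

ssyt : (r : ℕ) → List ℕ → List (Filling r)
ssyt r ρ = filter semistandard? (fillings r ρ)

module _ {c ℓ} (R : RawSemiring c ℓ) where
  open RawSemiring R

  -- s_ρ(x₀, …, x_{r-1}) as a sum over semistandard tableaux, for ρ the
  -- weakly decreasing list of the parts.
  schur : ∀ {r} → List ℕ → Vector Carrier r → Carrier
  schur {r} ρ x =
    foldr _+_ 0# (map (λ T → foldr _*_ 1# (map x (concat T))) (ssyt r ρ))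

-- A formal power series in q, by its coefficients.
PowerSeries : Set
PowerSeries = ℕ → ℤ

open RawSemiringDefs (RawRing.rawSemiring ℤ.+-*-rawRing) public
  using () renaming (sum to sumℤ)

constant : ℤ → PowerSeries
constant a zero    = a
constant a (suc _) = 0ℤ

ℤ⟦q⟧ : RawRing 0ℓ 0ℓ
ℤ⟦q⟧ = record
  { Carrier = PowerSeries
  ; _≈_     = λ f g → ∀ d → f d ≡ g d
  ; _+_     = λ f g d → f d ℤ.+ g d
  ; _*_     = λ f g d → sumℤ {suc d} (λ i → f (toℕ i) ℤ.* g (d ∸ toℕ i))
  ; -_      = λ f d → ℤ.- f d
  ; 0#      = constant 0ℤ
  ; 1#      = constant 1ℤ
  }

open RawRing ℤ⟦q⟧ public using (_≈_; _+_; _*_; -_; 0#; 1#)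
open RawSemiringDefs (RawRing.rawSemiring ℤ⟦q⟧) public using (_^_; product)

q : PowerSeries
q 1 = 1ℤ
q _ = 0ℤ

infixl 6 _-_
_-_ : PowerSeries → PowerSeries → PowerSeries
f - g = f + (- g)

-- The coefficients of degrees d, d ∸ 1, …, 0 of the inverse.
recips : PowerSeries → (d : ℕ) → Vector ℤ (suc d)
recips f zero    = 1ℤ Vector.∷ Vector.[]
recips f (suc d) =
  (ℤ.- sumℤ (λ j → f (suc (toℕ j)) ℤ.* recips f d j)) Vector.∷ recips f d

-- The multiplicative inverse of a series with constant term 1
-- (see *-recip); other series are not of interest.
recip : PowerSeries → PowerSeries
recip f d = recips f d Fin.zero

recips-recip : ∀ f d (j : Fin (suc d)) → recips f d j ≡ recip f (d ∸ toℕ j)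
recips-recip f d       Fin.zero    = refl
recips-recip f (suc d) (Fin.suc j) = recips-recip f d j

sumℤ-cong : ∀ {n} {x y : Vector ℤ n} → (∀ i → x i ≡ y i) → sumℤ x ≡ sumℤ y
sumℤ-cong {zero}  x≗y = refl
sumℤ-cong {suc n} x≗y =
  cong₂ ℤ._+_ (x≗y Fin.zero) (sumℤ-cong (x≗y ∘ Fin.suc))

*-recip : ∀ f → f 0 ≡ 1ℤ → f * recip f ≈ 1#
*-recip f f₀≡1 zero    = cong (λ a → a ℤ.* 1ℤ ℤ.+ 0ℤ) f₀≡1
*-recip f f₀≡1 (suc d) = begin
  f 0 ℤ.* (ℤ.- S) ℤ.+ S′  ≡⟨ cong (λ a → a ℤ.* (ℤ.- S) ℤ.+ S′) f₀≡1 ⟩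
  1ℤ ℤ.* (ℤ.- S) ℤ.+ S′   ≡⟨ cong₂ ℤ._+_ (ℤ.*-identityˡ (ℤ.- S)) (sym S≡S′) ⟩
  (ℤ.- S) ℤ.+ S           ≡⟨ ℤ.+-inverseˡ S ⟩
  0ℤ                      ∎
  where
  open ≡-Reasoning
  S S′ : ℤ
  S  = sumℤ {suc d} (λ j → f (suc (toℕ j)) ℤ.* recips f d j)
  S′ = sumℤ {suc d} (λ j → f (suc (toℕ j)) ℤ.* recip f (d ∸ toℕ j))
  S≡S′ : S ≡ S′
  S≡S′ = sumℤ-cong (λ j → cong (f (suc (toℕ j)) ℤ.*_) (recips-recip f d j))

[1-q^]₀≡1 : ∀ i → (1# - q ^ suc i) 0 ≡ 1ℤ
[1-q^]₀≡1 i = cong (λ a → 1ℤ ℤ.+ ℤ.- (a ℤ.+ 0ℤ)) (ℤ.*-zeroˡ ((q ^ i) 0))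

-- The members of P of corner volume d, as arrays.
Fiber : Pred PlanePartition 0ℓ → ℕ → Setoid 0ℓ 0ℓ
Fiber P d = record
  { Carrier       = Σ PlanePartition (P ∩ (λ π → cornerVolume π ≡ d))
  ; _≈_           = _≗ₚ_ on proj₁
  ; isEquivalence = record
    { refl  = λ i j → refl
    ; sym   = λ π≗σ i j → sym (π≗σ i j)
    ; trans = λ π≗σ σ≗τ i j → trans (π≗σ i j) (σ≗τ i j)
    }
  }

-- The sum of q^|π|_c over the set P is the series F: for every d there
-- are finitely many π in P with |π|_c = d, and their number is the
-- coefficient of q^d in F.
∑[π∈_]q^∣π∣c≈_ : Pred PlanePartition 0ℓ → PowerSeries → Set
∑[π∈ P ]q^∣π∣c≈ F =
  ∀ d → ∃ λ N → Inverse (Fiber P d) (≡-setoid (Fin N)) × F d ≡ + N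

s : ∀ {r} → List ℕ → Vector PowerSeries r → PowerSeries
s = schur (RawRing.rawSemiring ℤ⟦q⟧)

ones : (r : ℕ) → Vector PowerSeries r
ones r = Vector.replicate r 1#

q-powers : (m : ℕ) → Vector PowerSeries m
q-powers m i = q ^ suc (toℕ i)

-- Let r(i,l) be the number of entries ≥ l in row i of π. The entries equal to l in
-- row i that are not repeated below number d(i,l) = r(i,l) − max(r(i,l+1), r(i+1,l)),
-- so |π|_c is the sum of the l·d(i,l). This is the recursion of last passage
-- percolation: d is an arbitrary matrix and determines r, which gives the product
-- formula. For at most k columns put e = k − r. The RSK correspondence, one local
-- reflection (growth rule) at a time, turns the columns e(·,m), …, e(·,1) into a
-- Gelfand–Tsetlin triangle whose edge is the last column e(·,1), together with a
-- chain of horizontal strips from its top row to (kⁿ), the l-th of which has as many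
-- cells as the sum of d(·,l). Triangle and chain form a semistandard tableau of
-- shape (kⁿ), the triangle holding the letters of weight 1. The shape of π is all of
-- (kⁿ) when the edge vanishes, and then the triangle is one letter smaller.

module Submission where

open import Defs
  using (PlanePartition; entry; column-decr; row-decr; finite; bound; _≗ₚ_; Des?; cornerVolume;
         ColumnsAtMost; PP; PP′; PP∞; Filling; words; fillings; Semistandard; semistandard?; ssyt;
         PowerSeries; sumℤ; sumℤ-cong; recip; *-recip; [1-q^]₀≡1; 0#; 1#; q; s; ones; q-powers;
         product; ∑[π∈_]q^∣π∣c≈_)
  renaming (_+_ to _⊕_; _*_ to _⊛_; _^_ to _⊛^_; _-_ to _⊝_)
open import Data.Fin as Fin using (Fin; toℕ; fromℕ<; splitAt; _↑ʳ_)
import Data.Fin.Properties as Fin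
open import Data.Integer as ℤ using (ℤ; 0ℤ; 1ℤ)
import Data.Integer.Properties as ℤ
open import Algebra.Properties.CommutativeMonoid.Sum ℤ.+-0-commutativeMonoid using (∑-distrib-+)
open import Data.List as List
  using (List; []; _∷_; length; filter; replicate; reverse; concat; tabulate; lookup; allFin;
         upTo; applyUpTo; cartesianProduct; cartesianProductWith)
open import Data.List.Properties as List
  using (length-++; length-replicate; length-filter; filter-++; filter-all; filter-none;
         filter-accept; filter-reject; ++-identityʳ; map-++; map-∘; map-id-local; length-map;
         length-reverse; reverse-involutive; ∷-injective)
open import Data.List.Membership.Propositional using (_∈_)
open import Data.List.Membership.Propositional.Properties
  using (∈-cartesianProductWith⁺; ∈-cartesianProductWith⁻; ∈-allFin; ∈-filter⁺; ∈-filter⁻;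
         ∈-concat⁺′; ∈-concat⁻′; ∈-tabulate⁺; ∈-tabulate⁻; ∈-lookup)
open import Data.List.Relation.Binary.Permutation.Propositional using (↭-sym)
open import Data.List.Relation.Binary.Permutation.Propositional.Properties
  using (↭-reverse; All-resp-↭; map⁺)
open import Data.List.Relation.Binary.Prefix.Heterogeneous using (Prefix; []; _∷_)
import Data.List.Relation.Binary.Prefix.Heterogeneous.Properties as Prefix
open import Data.List.Relation.Unary.All as All using (All; []; _∷_)
import Data.List.Relation.Unary.All.Properties as All
open import Data.List.Relation.Unary.AllPairs using ([]; _∷_)
import Data.List.Relation.Unary.AllPairs.Properties as AllPairs
open import Data.List.Relation.Unary.Any as Any using (here)
open import Data.List.Relation.Unary.Any.Properties using (lookup-index)
open import Data.List.Relation.Unary.Linked as Linked using (Linked; []; [-]; _∷_)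
import Data.List.Relation.Unary.Linked.Properties as Linked
open import Data.List.Relation.Unary.Unique.Propositional using (Unique)
import Data.List.Relation.Unary.Unique.Propositional.Properties as Unique
open import Data.Nat hiding (_^_)
open import Data.Nat.Divisibility
  using (_∣_; _∣?_; divides; ∣-refl; ∣m∣n⇒∣m+n; ∣m+n∣m⇒∣n; ∣⇒≤)
open import Data.Nat.Induction using (<-rec)
import Data.Nat.ListAction as ℕ
import Data.Nat.ListAction.Properties as ℕ
open import Data.Nat.Properties
open import Data.Nat.Tactic.RingSolver using (solve-∀)
open import Data.Product
open import Data.Sum using (inj₁; inj₂)
open import Data.Unit using (⊤; tt)
open import Data.Vec as Vec using (Vec; []; _∷_; sum; toList; _∷ʳ_)
import Data.Vec.Functional as Vector
open Vector using (Vector)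
import Data.Vec.Properties as Vec
import Data.Vec.Relation.Unary.All as VecAll
open VecAll using ([]; _∷_)
open import Function using (_∘_; id; flip; mk⇔; Equivalence)
open import Level using (0ℓ)
open import Relation.Binary using (Rel; tri<; tri≈; tri>)
open import Relation.Binary.PropositionalEquality
open import Relation.Nullary
open import Relation.Unary using (Pred; Decidable)

-- Gelfand–Tsetlin triangles and the local growth rule

-- A step replaces the edge of a triangle and must lose nothing. In each row the new edge entry is
-- prescribed, and the other parts of the new row are exactly as many as those of the old next
-- shorter row, which the step overwrites. With the old longer row and the new shorter row fixed,
-- these two vectors range over one and the same box, a product of intervals, so reversing every
-- interval is a bijection between them. The weight comes from the same rule. An entry and its image
-- add up to the two ends of the interval, a maximum and a minimum of neighbouring parts; since a
-- maximum and a minimum of the same two numbers add up to their sum, all cancels along the row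
-- except one minimum at its small end. Against the prescribed edge entry this leaves min(e(i,l+1),
-- e(i+1,l)) - e(i,l), which is d(i,l). The process starts at the triangle with top row (kⁿ).
-- Interlacing admits only one such triangle, so the start holds no information and the columns
-- alone correspond to the tableau.

infix 4 _≤ʰ_
_≤ʰ_ : ∀ {n} → ℕ → Vec ℕ n → Set
a ≤ʰ []      = ⊤
a ≤ʰ (c ∷ _) = a ≤ c

infixl 7 _⊓ʰ_
-- A missing head counts as infinity, here as in `≤ʰ`: nothing bounds a part from above once the
-- shorter vector is exhausted.
_⊓ʰ_ : ∀ {n} → ℕ → Vec ℕ n → ℕ
b ⊓ʰ []      = b
b ⊓ʰ (c ∷ _) = b ⊓ c

-- Partitions are listed from the smallest part to the largest.
Strip : ∀ {n} → Vec ℕ n → Vec ℕ n → Set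
Strip []      []      = ⊤
Strip (a ∷ α) (c ∷ γ) = c ≤ a × a ≤ʰ γ × Strip α γ

data Tri : ℕ → Set where
  []  : Tri 0
  _∷_ : ∀ {i} → Vec ℕ (suc i) → Tri i → Tri (suc i)

top : ∀ {i} → Tri i → Vec ℕ i
top []      = []
top (β ∷ _) = β

-- Position `i` belongs to row `i` of the plane partition. The smallest parts increase towards the
-- shorter rows of a triangle, just as k - r increases down the rows of a plane partition.
edge : ∀ {i} → Tri i → Vec ℕ i
edge []            = []
edge ((e ∷ _) ∷ T) = e ∷ edge T

Interlacing : ∀ {i} → Tri i → Set
Interlacing []      = ⊤
Interlacing (β ∷ T) = Strip β (0 ∷ top T) × Interlacing T

-- If a step turns the adjacent rows b ∷ β, α of a triangle into e ∷ δ, γ, then given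
-- β and γ both α and δ range over this same box, on which reflect is an involution.
Between : ∀ {i} (b : ℕ) (β γ ξ : Vec ℕ i) → Set
Between b β γ ξ = b ≤ʰ ξ × Strip β ξ × Strip ξ γ

-- The piecewise-linear toggle. The ends `b ⊔ c` and `b′ ⊓ʰ γ` of the interval for `x` do not
-- involve the other coordinates of `ξ`, so all coordinates can be toggled independently.
reflect : ∀ {i} (b : ℕ) (β γ ξ : Vec ℕ i) → Vec ℕ i
reflect b []       []      []      = []
reflect b (b′ ∷ β) (c ∷ γ) (x ∷ ξ) =
  (b ⊔ c) + (b′ ⊓ʰ γ) ∸ x ∷ reflect b′ β γ ξ

≤⊓ʰ : ∀ {n a b} (γ : Vec ℕ n) → a ≤ b → a ≤ʰ γ → a ≤ b ⊓ʰ γ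
≤⊓ʰ []      a≤b _   = a≤b
≤⊓ʰ (_ ∷ _) a≤b a≤c = ⊓-glb a≤b a≤c

⊓ʰ≤ : ∀ {n} b (γ : Vec ℕ n) → b ⊓ʰ γ ≤ b
⊓ʰ≤ b []      = ≤-refl
⊓ʰ≤ b (c ∷ _) = m⊓n≤m b c

⊓ʰ≤ʰ : ∀ {n} b (γ : Vec ℕ n) → b ⊓ʰ γ ≤ʰ γ
⊓ʰ≤ʰ b []      = tt
⊓ʰ≤ʰ b (c ∷ _) = m⊓n≤n b c

≤ʰ-trans : ∀ {n a b} (γ : Vec ℕ n) → a ≤ b → b ≤ʰ γ → a ≤ʰ γ
≤ʰ-trans []      _   _   = tt
≤ʰ-trans (_ ∷ _) a≤b b≤c = ≤-trans a≤b b≤c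

reflect-≥ : ∀ {lo hi x} → x ≤ hi → lo ≤ lo + hi ∸ x
reflect-≥ {lo} {hi} {x} x≤hi = subst (lo ≤_) (sym (+-∸-assoc lo x≤hi)) (m≤m+n lo _)

reflect-≤ : ∀ {lo hi x} → lo ≤ x → lo + hi ∸ x ≤ hi
reflect-≤ {lo} {hi} {x} lo≤x =
  ≤-trans (∸-monoʳ-≤ (lo + hi) lo≤x) (≤-reflexive (m+n∸m≡n lo hi))

module Bounds {i b b′ c x} {β γ ξ : Vec ℕ i}
              (btw : Between b (b′ ∷ β) (c ∷ γ) (x ∷ ξ)) where
  private
    b≤x = proj₁ btw
    x≤b′ = proj₁ (proj₁ (proj₂ btw))
    c≤x = proj₁ (proj₂ (proj₂ btw))
    x≤γ = proj₁ (proj₂ (proj₂ (proj₂ btw)))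
  low : b ⊔ c ≤ x
  low = ⊔-lub b≤x c≤x
  high : x ≤ b′ ⊓ʰ γ
  high = ≤⊓ʰ γ x≤b′ x≤γ
  rest : Between b′ β γ ξ
  rest = proj₁ (proj₂ (proj₁ (proj₂ btw))) , proj₂ (proj₂ (proj₁ (proj₂ btw)))
       , proj₂ (proj₂ (proj₂ (proj₂ btw)))

between-∷ : ∀ {i b b′ c x} {β γ ξ : Vec ℕ i} →
  b ⊔ c ≤ x → x ≤ b′ ⊓ʰ γ → Between b′ β γ ξ →
  Between b (b′ ∷ β) (c ∷ γ) (x ∷ ξ)
between-∷ {b = b} {b′} {c} {γ = γ} lo hi (p , q , r) =
  ≤-trans (m≤m⊔n b c) lo ,
  (≤-trans hi (⊓ʰ≤ b′ γ) , p , q) ,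
  (≤-trans (m≤n⊔m b c) lo , ≤ʰ-trans γ hi (⊓ʰ≤ʰ b′ γ) , r)

reflect-between : ∀ {i} b (β γ ξ : Vec ℕ i) →
  Between b β γ ξ → Between b β γ (reflect b β γ ξ)
reflect-between b []       []      []      _   = _
reflect-between b (b′ ∷ β) (c ∷ γ) (x ∷ ξ) btw =
  between-∷ {β = β} (reflect-≥ high) (reflect-≤ low) (reflect-between b′ β γ ξ rest)
  where open Bounds {β = β} btw

reflect-involutive : ∀ {i} b (β γ ξ : Vec ℕ i) →
  Between b β γ ξ → reflect b β γ (reflect b β γ ξ) ≡ ξ
reflect-involutive b []       []      []      _   = refl
reflect-involutive b (b′ ∷ β) (c ∷ γ) (x ∷ ξ) btw =
  cong₂ _∷_ (m∸[m∸n]≡n (≤-trans high (m≤n+m _ (b ⊔ c))))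
            (reflect-involutive b′ β γ ξ rest)
  where open Bounds {β = β} btw

⊔+⊓ : ∀ b c → (b ⊔ c) + (b ⊓ c) ≡ b + c
⊔+⊓ zero    c       = +-identityʳ c
⊔+⊓ (suc b) zero    = refl
⊔+⊓ (suc b) (suc c) = cong suc (trans (+-suc _ _) (trans (cong suc (⊔+⊓ b c)) (sym (+-suc b c))))

-- A coordinate and its image add up to `b ⊔ c` plus `b′ ⊓ʰ γ`. The minimum from one coordinate
-- pairs with the maximum from the next, and each such pair is a plain sum by `⊔+⊓`; only the
-- minimum before the first coordinate is left over.
reflect-sum : ∀ {i} b (β γ ξ : Vec ℕ i) → Between b β γ ξ →
  sum ξ + sum (reflect b β γ ξ) + b ⊓ʰ γ ≡ b + sum β + sum γ
reflect-sum b []       []      []      _   = solve-∀-id b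
  where solve-∀-id : ∀ b → b ≡ b + 0 + 0
        solve-∀-id = solve-∀
reflect-sum b (b′ ∷ β) (c ∷ γ) (x ∷ ξ) btw = begin
  (x + X) + (x̄ + X̄) + (b ⊓ c)        ≡⟨ shuffle₁ x X x̄ X̄ (b ⊓ c) ⟩
  (x + x̄) + (X + X̄) + (b ⊓ c)        ≡⟨ cong (λ s → s + (X + X̄) + (b ⊓ c)) (m+[n∸m]≡n (≤-trans high (m≤n+m _ (b ⊔ c)))) ⟩
  ((b ⊔ c) + h) + (X + X̄) + (b ⊓ c)  ≡⟨ shuffle₂ (b ⊔ c) (b ⊓ c) h (X + X̄) ⟩
  ((b ⊔ c) + (b ⊓ c)) + (X + X̄ + h)  ≡⟨ cong₂ _+_ (⊔+⊓ b c) (reflect-sum b′ β γ ξ rest) ⟩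
  (b + c) + (b′ + sum β + sum γ)     ≡⟨ shuffle₃ b c b′ (sum β) (sum γ) ⟩
  b + (b′ + sum β) + (c + sum γ)     ∎
  where
  open Bounds {β = β} btw
  open ≡-Reasoning
  h = b′ ⊓ʰ γ
  X = sum ξ
  X̄ = sum (reflect b′ β γ ξ)
  x̄ = (b ⊔ c) + h ∸ x
  shuffle₁ : ∀ x X y Y z → (x + X) + (y + Y) + z ≡ (x + y) + (X + Y) + z
  shuffle₁ = solve-∀
  shuffle₂ : ∀ m m′ h Y → (m + h) + Y + m′ ≡ (m + m′) + (Y + h)
  shuffle₂ = solve-∀
  shuffle₃ : ∀ b c b′ B C → (b + c) + (b′ + B + C) ≡ b + (b′ + B) + (c + C)
  shuffle₃ = solve-∀

EdgeStep : ∀ {i} → Vec ℕ i → Vec ℕ i → Set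
EdgeStep []      []        = ⊤
EdgeStep (e ∷ E) (e′ ∷ E′) = e′ ≤ e × e′ ≤ʰ E′ × EdgeStep E E′

-- Each summand is d(i,l) written in terms of e = k - r, with a minimum in place of the maximum.
drop : ∀ {i} → Vec ℕ i → Vec ℕ i → ℕ
drop []      []        = 0
drop (e ∷ E) (e′ ∷ E′) = (e ⊓ʰ E′ ∸ e′) + drop E E′

-- Each new row is built from the new next shorter row, so the recursion reaches the shortest row
-- first. Only the smallest part of a row is not determined by the reflection; it is read from the
-- column.
step : ∀ {i} → Tri i → Vec ℕ i → Tri i
step []            []      = []
step ((b ∷ β) ∷ T) (e ∷ E) =
  (e ∷ reflect b β (top (step T E)) (top T)) ∷ step T E

-- The inverse proceeds from the longest row to the shortest: the old top row is given, and each
-- reflection returns the next old row, which is the input for the rest.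
unstep : ∀ {i} → Vec ℕ i → Tri i → Tri i
unstep []      []            = []
unstep (b ∷ β) ((e ∷ δ) ∷ T) = (b ∷ β) ∷ unstep (reflect b β (top T) δ) T

top-unstep : ∀ {i} (β : Vec ℕ i) (T : Tri i) → top (unstep β T) ≡ β
top-unstep []      []            = refl
top-unstep (b ∷ β) ((e ∷ δ) ∷ T) = refl

⊓ʰ-edge : ∀ {i} b (T : Tri i) → b ⊓ʰ edge T ≡ b ⊓ʰ top T
⊓ʰ-edge b []            = refl
⊓ʰ-edge b ((e ∷ _) ∷ T) = refl

≤ʰ-edge : ∀ {i a} (T : Tri i) → a ≤ʰ edge T → a ≤ʰ top T
≤ʰ-edge []            _ = tt
≤ʰ-edge ((e ∷ _) ∷ T) p = p

≤ʰ-top : ∀ {i a} (T : Tri i) → a ≤ʰ top T → a ≤ʰ edge T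
≤ʰ-top []            _ = tt
≤ʰ-top ((e ∷ _) ∷ T) p = p

edge-step : ∀ {i} (T : Tri i) (E : Vec ℕ i) → edge (step T E) ≡ E
edge-step []            []      = refl
edge-step ((b ∷ β) ∷ T) (e ∷ E) = cong (e ∷_) (edge-step T E)

step-strip : ∀ {i} (T : Tri i) E → Interlacing T → EdgeStep (edge T) E →
  Interlacing (step T E) × Strip (top T) (top (step T E))
step-strip []            []      _                      _                 = tt , tt
step-strip ((b ∷ β) ∷ T) (e ∷ E) ((_ , b≤α , βα) , iT) (e≤b , e≤E , es)
  with step-strip T E iT es
... | iT′ , αγ with reflect-between b β (top (step T E)) (top T) (b≤α , βα , αγ)
... | b≤δ , βδ , δγ =
  ((z≤n , ≤ʰ-edge (step T E) (subst (e ≤ʰ_) (sym (edge-step T E)) e≤E) , δγ) , iT′)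
  , (e≤b , b≤δ , βδ)

unstep-edge : ∀ {i} (β : Vec ℕ i) (T : Tri i) → Interlacing T → Strip β (top T) →
  Interlacing (unstep β T) × EdgeStep (edge (unstep β T)) (edge T)
unstep-edge []      []            _                       _                = tt , tt
unstep-edge (b ∷ β) ((e ∷ δ) ∷ T) ((_ , e≤γ , δγ) , iT) (e≤b , b≤δ , βδ)
  with reflect-between b β (top T) δ (b≤δ , βδ , δγ)
... | b≤α , βα , αγ with unstep-edge (reflect b β (top T) δ) T iT αγ
... | iT′ , es =
  ((z≤n , subst (b ≤ʰ_) (sym eq) b≤α , subst (Strip β) (sym eq) βα) , iT′)
  , (e≤b , ≤ʰ-top T e≤γ , es)
  where eq = top-unstep (reflect b β (top T) δ) T

unstep-step : ∀ {i} (T : Tri i) E → Interlacing T → EdgeStep (edge T) E →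
  unstep (top T) (step T E) ≡ T
unstep-step []            []      _                      _            = refl
unstep-step ((b ∷ β) ∷ T) (e ∷ E) ((_ , b≤α , βα) , iT) (_ , _ , es) =
  cong ((b ∷ β) ∷_) (trans
    (cong (λ α → unstep α (step T E))
      (reflect-involutive b β (top (step T E)) (top T)
        (b≤α , βα , proj₂ (step-strip T E iT es))))
    (unstep-step T E iT es))

step-unstep : ∀ {i} (β : Vec ℕ i) (T : Tri i) → Interlacing T → Strip β (top T) →
  step (unstep β T) (edge T) ≡ T
step-unstep []      []            _                      _              = refl
step-unstep (b ∷ β) ((e ∷ δ) ∷ T) ((_ , e≤γ , δγ) , iT) (_ , b≤δ , βδ) =
  cong₂ (λ δ′ T′ → (e ∷ δ′) ∷ T′)
    (trans (cong₂ (reflect b β) (cong top ih) (top-unstep α T))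
           (reflect-involutive b β (top T) δ btw))
    ih
  where
  α = reflect b β (top T) δ
  btw : Between b β (top T) δ
  btw = b≤δ , βδ , δγ
  ih : step (unstep α T) (edge T) ≡ T
  ih = step-unstep α T iT (proj₂ (proj₂ (reflect-between b β (top T) δ btw)))

-- The unpaired minimum of `reflect-sum` is `b ⊓ʰ E`. The new row has `e` in its place, which is
-- smaller by the first summand of `drop`; the remaining summands come from the shorter rows by
-- induction.
step-sum : ∀ {i} (T : Tri i) E → Interlacing T → EdgeStep (edge T) E →
  sum (top (step T E)) + drop (edge T) E ≡ sum (top T)
step-sum []            []      _                      _              = refl
step-sum ((b ∷ β) ∷ T) (e ∷ E) ((_ , b≤α , βα) , iT) (e≤b , e≤E , es) =
  -- `reflect-sum` also contains the old shorter row, so its sum is added on both sides.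
  +-cancelˡ-≡ (sum (top T)) _ _ (begin
    sum (top T) + (e + D + (b ⊓ʰ E ∸ e + d))   ≡⟨ shuffle (sum (top T)) e D (b ⊓ʰ E ∸ e) d ⟩
    (sum (top T) + D + (e + (b ⊓ʰ E ∸ e))) + d ≡⟨ cong (λ h → sum (top T) + D + h + d) (m+[n∸m]≡n (≤⊓ʰ E e≤b e≤E)) ⟩
    (sum (top T) + D + b ⊓ʰ E) + d             ≡⟨ cong (λ h → sum (top T) + D + h + d) cap ⟩
    (sum (top T) + D + b ⊓ʰ top T′) + d        ≡⟨ cong (_+ d) (reflect-sum b β (top T′) (top T) (b≤α , βα , proj₂ (step-strip T E iT es))) ⟩
    (b + sum β + sum (top T′)) + d             ≡⟨ +-assoc (b + sum β) (sum (top T′)) d ⟩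
    b + sum β + (sum (top T′) + d)             ≡⟨ cong (b + sum β +_) (step-sum T E iT es) ⟩
    b + sum β + sum (top T)                    ≡⟨ +-comm (b + sum β) (sum (top T)) ⟩
    sum (top T) + (b + sum β)                  ∎)
  where
  open ≡-Reasoning
  T′ = step T E
  D = sum (reflect b β (top T′) (top T))
  d = drop (edge T) E
  cap : b ⊓ʰ E ≡ b ⊓ʰ top T′
  cap = trans (cong (b ⊓ʰ_) (sym (edge-step T E))) (⊓ʰ-edge b T′)
  shuffle : ∀ t e D h d → t + (e + D + (h + d)) ≡ (t + D + (e + h)) + d
  shuffle = solve-∀

-- The RSK correspondence

EdgeChain : ∀ {n m} → Vec ℕ n → Vec (Vec ℕ n) m → Set
EdgeChain v []       = ⊤
EdgeChain v (E ∷ Es) = EdgeStep v E × EdgeChain E Es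

lastFrom : ∀ {n m} → Vec ℕ n → Vec (Vec ℕ n) m → Vec ℕ n
lastFrom v []       = v
lastFrom v (E ∷ Es) = lastFrom E Es

-- The head of a list of m columns belongs to the variable q^m.
edgeWeight : ∀ {n m} → Vec ℕ n → Vec (Vec ℕ n) m → ℕ
edgeWeight         v []       = 0
edgeWeight {m = m} v (E ∷ Es) = m * drop v E + edgeWeight E Es

outer : ∀ {n m} → Tri n → Vec (Vec ℕ n) m → Vec ℕ n
outer T []      = top T
outer T (β ∷ _) = β

StripChain : ∀ {n m} → Tri n → Vec (Vec ℕ n) m → Set
StripChain T []       = ⊤
StripChain T (β ∷ βs) = Strip β (outer T βs) × StripChain T βs

stripWeight : ∀ {n m} → Tri n → Vec (Vec ℕ n) m → ℕ
stripWeight         T []       = 0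
stripWeight {m = m} T (β ∷ βs) = m * (sum β ∸ sum (outer T βs)) + stripWeight T βs

-- The top row is recorded before the step shrinks it, so every recorded vector is the outer end of
-- the strip that its own step removes.
rsk : ∀ {n m} → Tri n → Vec (Vec ℕ n) m → Tri n × Vec (Vec ℕ n) m
rsk T []       = T , []
rsk T (E ∷ Es) = let T′ , βs = rsk (step T E) Es in T′ , top T ∷ βs

unrsk : ∀ {n m} → Tri n → Vec (Vec ℕ n) m → Tri n × Vec (Vec ℕ n) m
unrsk T []       = T , []
unrsk T (β ∷ βs) = let T′ , Es = unrsk T βs in unstep β T′ , edge T′ ∷ Es

outer-rsk : ∀ {n m} (T : Tri n) (Es : Vec (Vec ℕ n) m) →
  let T′ , βs = rsk T Es in outer T′ βs ≡ top T
outer-rsk T []       = refl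
outer-rsk T (E ∷ Es) = refl

top-unrsk : ∀ {n m} (T : Tri n) (βs : Vec (Vec ℕ n) m) →
  top (proj₁ (unrsk T βs)) ≡ outer T βs
top-unrsk T []       = refl
top-unrsk T (β ∷ βs) = top-unstep β (proj₁ (unrsk T βs))

rsk-strips : ∀ {n m} (T : Tri n) (Es : Vec (Vec ℕ n) m) →
  Interlacing T → EdgeChain (edge T) Es → let T′ , βs = rsk T Es in
  Interlacing T′ × StripChain T′ βs
rsk-strips T []       iT _         = iT , tt
rsk-strips T (E ∷ Es) iT (es , ec) =
  let iT′ , st = step-strip T E iT es
      iT″ , sc = rsk-strips (step T E) Es iT′
                   (subst (λ v → EdgeChain v Es) (sym (edge-step T E)) ec)
  in iT″ , subst (Strip (top T)) (sym (outer-rsk (step T E) Es)) st , sc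

edge-rsk : ∀ {n m} (T : Tri n) (Es : Vec (Vec ℕ n) m) →
  edge (proj₁ (rsk T Es)) ≡ lastFrom (edge T) Es
edge-rsk T []       = refl
edge-rsk T (E ∷ Es) = trans (edge-rsk (step T E) Es) (cong (λ v → lastFrom v Es) (edge-step T E))

rsk-weight : ∀ {n m} (T : Tri n) (Es : Vec (Vec ℕ n) m) →
  Interlacing T → EdgeChain (edge T) Es → let T′ , βs = rsk T Es in
  stripWeight T′ βs ≡ edgeWeight (edge T) Es
rsk-weight         T []       iT _         = refl
rsk-weight {m = m} T (E ∷ Es) iT (es , ec) = cong₂ _+_
  (cong (m *_) (begin
    sum (top T) ∸ sum (outer T′ βs)                         ≡⟨ cong (λ β → sum (top T) ∸ sum β) (outer-rsk T₁ Es) ⟩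
    sum (top T) ∸ sum (top T₁)                              ≡⟨ cong (_∸ sum (top T₁)) (sym (step-sum T E iT es)) ⟩
    sum (top T₁) + drop (edge T) E ∸ sum (top T₁)           ≡⟨ m+n∸m≡n (sum (top T₁)) _ ⟩
    drop (edge T) E                                         ∎))
  (trans (rsk-weight T₁ Es (proj₁ (step-strip T E iT es)) (subst (λ v → EdgeChain v Es) (sym (edge-step T E)) ec))
         (cong (λ v → edgeWeight v Es) (edge-step T E)))
  where
  open ≡-Reasoning
  T₁ = step T E
  T′ = proj₁ (rsk T₁ Es)
  βs = proj₂ (rsk T₁ Es)

unrsk-edges : ∀ {n m} (T : Tri n) (βs : Vec (Vec ℕ n) m) →
  Interlacing T → StripChain T βs → let T′ , Es = unrsk T βs in
  Interlacing T′ × EdgeChain (edge T′) Es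
unrsk-edges T []       iT _         = iT , tt
unrsk-edges T (β ∷ βs) iT (st , sc) =
  let iT′ , ec = unrsk-edges T βs iT sc
      iT″ , es = unstep-edge β (proj₁ (unrsk T βs)) iT′
                   (subst (Strip β) (sym (top-unrsk T βs)) st)
  in iT″ , es , ec

lastFrom-unrsk : ∀ {n m} (T : Tri n) (βs : Vec (Vec ℕ n) m) →
  let T′ , Es = unrsk T βs in lastFrom (edge T′) Es ≡ edge T
lastFrom-unrsk T []       = refl
lastFrom-unrsk T (β ∷ βs) = lastFrom-unrsk T βs

unrsk-rsk : ∀ {n m} (T : Tri n) (Es : Vec (Vec ℕ n) m) →
  Interlacing T → EdgeChain (edge T) Es → let T′ , βs = rsk T Es in
  unrsk T′ βs ≡ (T , Es)
unrsk-rsk T []       iT _         = refl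
unrsk-rsk T (E ∷ Es) iT (es , ec) = trans
  (cong (λ (T′ , Es′) → unstep (top T) T′ , edge T′ ∷ Es′)
    (unrsk-rsk (step T E) Es (proj₁ (step-strip T E iT es))
      (subst (λ v → EdgeChain v Es) (sym (edge-step T E)) ec)))
  (cong₂ (λ T′ E′ → T′ , E′ ∷ Es) (unstep-step T E iT es) (edge-step T E))

rsk-unrsk : ∀ {n m} (T : Tri n) (βs : Vec (Vec ℕ n) m) →
  Interlacing T → StripChain T βs → let T′ , Es = unrsk T βs in
  rsk T′ Es ≡ (T , βs)
rsk-unrsk T []       iT _         = refl
rsk-unrsk T (β ∷ βs) iT (st , sc) =
  cong₂ (λ (T″ , βs″) β″ → T″ , β″ ∷ βs″)
    (trans (cong (λ T″ → rsk T″ (proj₂ (unrsk T βs)))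
                 (step-unstep β (proj₁ (unrsk T βs)) (proj₁ (unrsk-edges T βs iT sc))
                   (subst (Strip β) (sym (top-unrsk T βs)) st)))
           (rsk-unrsk T βs iT sc))
    (top-unstep β (proj₁ (unrsk T βs)))

-- Triangles with a rectangular top row

constant-tri : ∀ n → ℕ → Tri n
constant-tri zero    k = []
constant-tri (suc n) k = Vec.replicate (suc n) k ∷ constant-tri n k

top-constant : ∀ n k → top (constant-tri n k) ≡ Vec.replicate n k
top-constant zero    k = refl
top-constant (suc n) k = refl

edge-constant : ∀ n k → edge (constant-tri n k) ≡ Vec.replicate n k
edge-constant zero    k = refl
edge-constant (suc n) k = cong (k ∷_) (edge-constant n k)

strip-constant : ∀ n k → Strip (Vec.replicate n k) (Vec.replicate n k)
strip-constant zero          k = tt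
strip-constant (suc zero)    k = ≤-refl , tt , tt
strip-constant (suc (suc n)) k = ≤-refl , ≤-refl , strip-constant (suc n) k

interlacing-constant : ∀ n k → Interlacing (constant-tri n k)
interlacing-constant zero          k = tt
interlacing-constant (suc zero)    k = (z≤n , tt , tt) , tt
interlacing-constant (suc (suc n)) k =
  (z≤n , ≤-refl , strip-constant (suc n) k) , interlacing-constant (suc n) k

squeeze : ∀ n k (ξ : Vec ℕ n) → k ≤ʰ ξ → Strip (Vec.replicate n k) ξ →
  ξ ≡ Vec.replicate n k
squeeze zero    k []      _   _              = refl
squeeze (suc n) k (x ∷ ξ) k≤x (x≤k , k≤ξ , s) =
  cong₂ _∷_ (≤-antisym x≤k k≤x) (squeeze n k ξ k≤ξ s)

-- Interlacing squeezes every shorter row between equal parts. This identifies the triangle that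
-- `unrsk` returns when the outer shape is a rectangle.
tri-constant : ∀ n k (T : Tri n) → Interlacing T → top T ≡ Vec.replicate n k →
  T ≡ constant-tri n k
tri-constant zero    k []      _                    _    = refl
tri-constant (suc n) k (.(Vec.replicate (suc n) k) ∷ T) ((_ , k≤α , s) , iT) refl =
  cong (Vec.replicate (suc n) k ∷_) (tri-constant n k T iT (squeeze n k (top T) k≤α s))

-- Tableaux and triangles

pad : ℕ → ℕ → List ℕ → List ℕ
pad L l w = w List.++ replicate (l ∸ length w) L

cut : ℕ → List ℕ → List ℕ
cut L = filter (_<? L)

Increasing : List ℕ → Set
Increasing = Linked _≤_

length-pad : ∀ L {l} w → length w ≤ l → length (pad L l w) ≡ l
length-pad L {l} w w≤l = begin
  length (pad L l w)                              ≡⟨ length-++ w ⟩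
  length w + length (replicate (l ∸ length w) L)  ≡⟨ cong (length w +_) (length-replicate (l ∸ length w)) ⟩
  length w + (l ∸ length w)                       ≡⟨ m+[n∸m]≡n w≤l ⟩
  l                                               ∎
  where open ≡-Reasoning

cut-pad : ∀ {L} l {w} → All (_< L) w → cut L (pad L l w) ≡ w
cut-pad {L} l {w} w<L = begin
  cut L (pad L l w)                               ≡⟨ filter-++ (_<? L) w _ ⟩
  cut L w List.++ cut L (replicate (l ∸ length w) L)   ≡⟨ cong₂ List._++_ (filter-all (_<? L) w<L) (filter-none (_<? L) (All.replicate⁺ (l ∸ length w) (<-irrefl refl))) ⟩
  w List.++ []                                         ≡⟨ ++-identityʳ w ⟩
  w                                               ∎
  where open ≡-Reasoning

constant-tail : ∀ {L w} → Increasing (L ∷ w) → All (_< suc L) w → w ≡ replicate (length w) L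
constant-tail [-]       _             = refl
constant-tail (L≤x ∷ i) (s≤s x≤L ∷ b) with ≤-antisym L≤x x≤L
... | refl = cong (_ ∷_) (constant-tail i b)

cut-constant : ∀ L n → cut L (replicate n L) ≡ []
cut-constant L n = filter-none (_<? L) (All.replicate⁺ n (<-irrefl refl))

pad-cut : ∀ {L w} → Increasing w → All (_< suc L) w → pad L (length w) (cut L w) ≡ w
pad-cut {L} {[]}    i b = refl
pad-cut {L} {x ∷ w} i (s≤s x≤L ∷ b) with x <? L
... | yes x<L rewrite filter-accept (_<? L) {xs = w} x<L = cong (x ∷_) (pad-cut (Linked.tail i) b)
... | no  x≮L with ≤-antisym x≤L (≮⇒≥ x≮L)
...   | refl rewrite filter-reject (_<? L) {xs = w} x≮L
                   | constant-tail i b | cut-constant L (length w) | length-replicate (length w) {L} = refl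

increasing-replicate : ∀ n L → Increasing (replicate n L)
increasing-replicate zero          L = []
increasing-replicate (suc zero)    L = [-]
increasing-replicate (suc (suc n)) L = ≤-refl ∷ increasing-replicate (suc n) L

increasing-++ : ∀ {L w} n → Increasing w → All (_< L) w → Increasing (w List.++ replicate n L)
increasing-++ {L} n       []        b         = increasing-replicate n L
increasing-++     zero    [-]       b         = [-]
increasing-++ {L} (suc n) [-]       (x<L ∷ _) = <⇒≤ x<L ∷ increasing-replicate (suc n) L
increasing-++     n       (x≤y ∷ i) (_ ∷ b)   = x≤y ∷ increasing-++ n i b

prefix-replicate : ∀ {L u} v n → n ≤ length u → All (_< L) u → Prefix _>_ (replicate n L) (u List.++ v)
prefix-replicate v zero    _       _         = []
prefix-replicate v (suc n) (s≤s p) (y<L ∷ b) = y<L ∷ prefix-replicate v n p b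

-- The length condition is the strip condition: every appended `L` lies under a letter of `u`, which
-- is smaller than `L`, and never under the padding `v` of the row above.
prefix-++ : ∀ {L w u} v n → Prefix _>_ w u → length w + n ≤ length u → All (_< L) u →
  Prefix _>_ (w List.++ replicate n L) (u List.++ v)
prefix-++ v n []      p       b       = prefix-replicate v n p b
prefix-++ v n (q ∷ s) (s≤s p) (_ ∷ b) = q ∷ prefix-++ v n s p b

cut-tail : ∀ {L x w} → Increasing (x ∷ w) → ¬ x < L → cut L w ≡ []
cut-tail {L} {x} {w} i x≮L = filter-none (_<? L)
  (All.map (λ x≤y y<L → x≮L (≤-<-trans x≤y y<L)) (bounded i))
  where
  bounded : ∀ {x w} → Increasing (x ∷ w) → All (x ≤_) w
  bounded [-]       = []
  bounded (x≤y ∷ i) = x≤y ∷ All.map (≤-trans x≤y) (bounded i)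

prefix-cut : ∀ {L w u} → Increasing w → All (_< suc L) w → Prefix _>_ w u →
  Prefix _>_ (cut L w) (cut L u)
prefix-cut i b [] = []
prefix-cut {L} {x ∷ w} {y ∷ u} i (s≤s x≤L ∷ b) (x>y ∷ s)
  rewrite filter-accept (_<? L) {xs = u} (<-≤-trans x>y x≤L) with x <? L
... | yes x<L rewrite filter-accept (_<? L) {xs = w} x<L = x>y ∷ prefix-cut (Linked.tail i) b s
-- By weak increase no letter after the first `L` survives the cut.
... | no  x≮L rewrite filter-reject (_<? L) {xs = w} x≮L | cut-tail i x≮L = []

-- Each letter of `w` is at most `L`, so the letter above it is smaller than `L` and survives the
-- cut. Hence the cells of the largest letter form a horizontal strip.
length-prefix-cut : ∀ {L w u} → All (_< suc L) w → Prefix _>_ w u → length w ≤ length (cut L u)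
length-prefix-cut b [] = z≤n
length-prefix-cut {L} {x ∷ w} {y ∷ u} (s≤s x≤L ∷ b) (x>y ∷ s)
  rewrite filter-accept (_<? L) {xs = u} (<-≤-trans x>y x≤L) = s≤s (length-prefix-cut b s)

-- The rows of a tableau, from bottom to top.
Rows : ℕ → Set
Rows n = Vec (List ℕ) n

infix 4 _⊏ʰ_
_⊏ʰ_ : ∀ {n} → List ℕ → Rows n → Set
w ⊏ʰ []      = ⊤
w ⊏ʰ (u ∷ _) = Prefix _>_ w u

Tableau : ∀ {n} → ℕ → Rows n → Set
Tableau L []       = ⊤
Tableau L (w ∷ ws) = Increasing w × All (_< L) w × w ⊏ʰ ws × Tableau L ws

lengths : ∀ {n} → Rows n → Vec ℕ n
lengths = Vec.map length

addLetter : ∀ {n} → ℕ → Vec ℕ n → Rows n → Rows n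
addLetter L = Vec.zipWith (pad L)

cutLetter : ∀ {n} → ℕ → Rows n → Rows n
cutLetter L = Vec.map (cut L)

lengths-addLetter : ∀ {n} L (β : Vec ℕ n) ws → Strip β (lengths ws) → lengths (addLetter L β ws) ≡ β
lengths-addLetter L []      []       _           = refl
lengths-addLetter L (l ∷ β) (w ∷ ws) (w≤l , _ , s) =
  cong₂ _∷_ (length-pad L w w≤l) (lengths-addLetter L β ws s)

tableau-addLetter : ∀ {n} L (β : Vec ℕ n) ws → Tableau L ws → Strip β (lengths ws) →
  Tableau (suc L) (addLetter L β ws)
tableau-addLetter L []      []       _             _               = tt
tableau-addLetter L (l ∷ β) (w ∷ ws) (i , b , p , t) (w≤l , l≤ , s) =
  increasing-++ (l ∸ length w) i b ,
  All.++⁺ (All.map m<n⇒m<1+n b) (All.replicate⁺ (l ∸ length w) ≤-refl) ,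
  below β ws t p l≤ ,
  tableau-addLetter L β ws t s
  where
  below : ∀ {n} (β : Vec ℕ n) ws → Tableau L ws → w ⊏ʰ ws → l ≤ʰ lengths ws →
          pad L l w ⊏ʰ addLetter L β ws
  below []      []       _           _ _  = tt
  below (l′ ∷ β) (u ∷ ws) (_ , b , _) p l≤ =
    prefix-++ _ (l ∸ length w) p (≤-trans (≤-reflexive (m+[n∸m]≡n w≤l)) l≤) b

cutLetter-addLetter : ∀ {n} L (β : Vec ℕ n) ws → Tableau L ws →
  cutLetter L (addLetter L β ws) ≡ ws
cutLetter-addLetter L []      []       _               = refl
cutLetter-addLetter L (l ∷ β) (w ∷ ws) (_ , b , _ , t) =
  cong₂ _∷_ (cut-pad l b) (cutLetter-addLetter L β ws t)

tableau-cutLetter : ∀ {n} L (ws : Rows n) → Tableau (suc L) ws → Tableau L (cutLetter L ws)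
tableau-cutLetter L []       _               = tt
tableau-cutLetter L (w ∷ ws) (i , b , p , t) =
  Linked-filter i , All.all-filter (_<? L) w , below ws p , tableau-cutLetter L ws t
  where
  Linked-filter : Increasing w → Increasing (cut L w)
  Linked-filter = Linked.filter⁺ (_<? L) ≤-trans
  below : ∀ {n} (ws : Rows n) → w ⊏ʰ ws → cut L w ⊏ʰ cutLetter L ws
  below []       _ = tt
  below (u ∷ ws) p = prefix-cut i b p

strip-cutLetter : ∀ {n} L (ws : Rows n) → Tableau (suc L) ws →
  Strip (lengths ws) (lengths (cutLetter L ws))
strip-cutLetter L []       _               = tt
strip-cutLetter L (w ∷ ws) (i , b , p , t) =
  length-filter (_<? L) w , below ws p , strip-cutLetter L ws t
  where
  below : ∀ {n} (ws : Rows n) → w ⊏ʰ ws → length w ≤ʰ lengths (cutLetter L ws)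
  below []       _ = tt
  below (u ∷ ws) p = length-prefix-cut b p

addLetter-cutLetter : ∀ {n} L (ws : Rows n) → Tableau (suc L) ws →
  addLetter L (lengths ws) (cutLetter L ws) ≡ ws
addLetter-cutLetter L []       _               = refl
addLetter-cutLetter L (w ∷ ws) (i , b , _ , t) =
  cong₂ _∷_ (pad-cut i b) (addLetter-cutLetter L ws t)

-- Entries strictly decrease on the way up, and n rows lie above this one.
bottom-entry : ∀ {n L x w} (ws : Rows n) → Tableau L ((x ∷ w) ∷ ws) → n ≤ x
bottom-entry []             _                        = z≤n
bottom-entry ((y ∷ u) ∷ ws) (_ , _ , (x>y ∷ _) , t) = ≤-<-trans (bottom-entry ws t) x>y

bottom-empty : ∀ {n} w (ws : Rows n) → Tableau n (w ∷ ws) → w ≡ []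
bottom-empty []      ws _ = refl
bottom-empty (x ∷ w) ws t@(_ , (x<n ∷ _) , _) = contradiction (bottom-entry ws t) (<⇒≱ x<n)

-- The standard reading of a Gelfand-Tsetlin triangle: the row of length `suc n` is the shape of the
-- part filled with the letters 0 to `n`. The letter `n` may open one further row, which is the
-- empty row put at the bottom.
triRows : ∀ {n} → Tri n → Rows n
triRows []                  = []
triRows {n = suc n} (β ∷ T) = addLetter n β ([] ∷ triRows T)

rowsTri : ∀ {n} → Rows n → Tri n
rowsTri {zero}  []         = []
-- Once the letter `n` is removed, the bottom row is empty by `cut-bottom` and can be left out.
rowsTri {suc n} ws@(_ ∷ us) = lengths ws ∷ rowsTri (cutLetter n us)

tableau-∷[] : ∀ {n L} (ws : Rows n) → Tableau L ws → Tableau L ([] ∷ ws)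
tableau-∷[] []       t = [] , [] , tt , t
tableau-∷[] (_ ∷ ws) t = [] , [] , [] , t

lengths-triRows : ∀ {n} (T : Tri n) → Interlacing T → lengths (triRows T) ≡ top T
lengths-triRows []                  _        = refl
lengths-triRows {n = suc n} (β ∷ T) (s , iT) = lengths-addLetter n β ([] ∷ triRows T)
  (subst (λ α → Strip β (0 ∷ α)) (sym (lengths-triRows T iT)) s)

tableau-triRows : ∀ {n} (T : Tri n) → Interlacing T → Tableau n (triRows T)
tableau-triRows []                  _        = tt
tableau-triRows {n = suc n} (β ∷ T) (s , iT) = tableau-addLetter n β ([] ∷ triRows T)
  (tableau-∷[] (triRows T) (tableau-triRows T iT))
  (subst (λ α → Strip β (0 ∷ α)) (sym (lengths-triRows T iT)) s)

cut-bottom : ∀ {n} w (ws : Rows n) → Tableau (suc n) (w ∷ ws) →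
  cutLetter n (w ∷ ws) ≡ [] ∷ cutLetter n ws
cut-bottom {n} w ws t =
  cong (_∷ cutLetter n ws) (bottom-empty (cut n w) _ (tableau-cutLetter n (w ∷ ws) t))

top-rowsTri : ∀ {n} (ws : Rows n) → top (rowsTri ws) ≡ lengths ws
top-rowsTri []       = refl
top-rowsTri (w ∷ ws) = refl

interlacing-rowsTri : ∀ {n} (ws : Rows n) → Tableau n ws → Interlacing (rowsTri ws)
interlacing-rowsTri []               _ = tt
interlacing-rowsTri {suc n} (w ∷ ws) t =
  subst (Strip (lengths (w ∷ ws)))
    (trans (cong lengths (cut-bottom w ws t)) (cong (0 ∷_) (sym (top-rowsTri (cutLetter n ws)))))
    (strip-cutLetter n (w ∷ ws) t) ,
  interlacing-rowsTri (cutLetter n ws) (proj₂ (proj₂ (proj₂ (tableau-cutLetter n (w ∷ ws) t))))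

triRows-rowsTri : ∀ {n} (ws : Rows n) → Tableau n ws → triRows (rowsTri ws) ≡ ws
triRows-rowsTri []               _ = refl
triRows-rowsTri {suc n} (w ∷ ws) t = begin
  addLetter n (lengths (w ∷ ws)) ([] ∷ triRows (rowsTri (cutLetter n ws)))
    ≡⟨ cong (λ us → addLetter n (lengths (w ∷ ws)) ([] ∷ us)) (triRows-rowsTri (cutLetter n ws) (proj₂ (proj₂ (proj₂ (tableau-cutLetter n (w ∷ ws) t))))) ⟩
  addLetter n (lengths (w ∷ ws)) ([] ∷ cutLetter n ws)
    ≡⟨ cong (addLetter n (lengths (w ∷ ws))) (cut-bottom w ws t) ⟨
  addLetter n (lengths (w ∷ ws)) (cutLetter n (w ∷ ws))
    ≡⟨ addLetter-cutLetter n (w ∷ ws) t ⟩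
  w ∷ ws ∎
  where open ≡-Reasoning

rowsTri-triRows : ∀ {n} (T : Tri n) → Interlacing T → rowsTri (triRows T) ≡ T
rowsTri-triRows []                            _             = refl
rowsTri-triRows {n = suc n} ((b ∷ β) ∷ T) iT@(s , iT′) =
  cong₂ _∷_ (lengths-triRows ((b ∷ β) ∷ T) iT)
    (trans (cong rowsTri (cutLetter-addLetter n β (triRows T) (tableau-triRows T iT′)))
           (rowsTri-triRows T iT′))

-- Edge 0 corresponds to tableaux with one letter fewer than rows, whose bottom
-- row is empty.
shift : ∀ {n} → Tri n → Tri (suc n)
shift []      = (0 ∷ []) ∷ []
shift (β ∷ T) = (0 ∷ β) ∷ shift T

unshift : ∀ {n} → Tri (suc n) → Tri n
unshift ((_ ∷ _) ∷ [])        = []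
unshift ((_ ∷ β) ∷ (γ ∷ T)) = β ∷ unshift (γ ∷ T)

top-shift : ∀ {n} (T : Tri n) → top (shift T) ≡ 0 ∷ top T
top-shift []      = refl
top-shift (β ∷ T) = refl

edge-shift : ∀ {n} (T : Tri n) → edge (shift T) ≡ Vec.replicate (suc n) 0
edge-shift []      = refl
edge-shift (β ∷ T) = cong (0 ∷_) (edge-shift T)

interlacing-shift : ∀ {n} (T : Tri n) → Interlacing T → Interlacing (shift T)
interlacing-shift []      _        = (z≤n , tt , tt) , tt
interlacing-shift (β ∷ T) (s , iT) =
  (subst (λ γ → Strip (0 ∷ β) (0 ∷ γ)) (sym (top-shift T)) (z≤n , z≤n , s)) , interlacing-shift T iT

unshift-shift : ∀ {n} (T : Tri n) → unshift (shift T) ≡ T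
unshift-shift []                = refl
unshift-shift (β ∷ [])          = refl
unshift-shift (β ∷ (γ ∷ T)) = cong (β ∷_) (unshift-shift (γ ∷ T))

shift-unshift : ∀ {n} (T : Tri (suc n)) → edge T ≡ Vec.replicate (suc n) 0 → shift (unshift T) ≡ T
shift-unshift ((.0 ∷ []) ∷ [])          refl = refl
shift-unshift ((b ∷ β) ∷ ((c ∷ γ) ∷ T)) eq
  with refl ← cong Vec.head eq =
  cong ((0 ∷ β) ∷_) (shift-unshift ((c ∷ γ) ∷ T) (cong Vec.tail eq))

interlacing-unshift : ∀ {n} (T : Tri (suc n)) → edge T ≡ Vec.replicate (suc n) 0 →
  Interlacing T → Interlacing (unshift T)
interlacing-unshift ((b ∷ []) ∷ [])          eq _                  = tt
interlacing-unshift ((b ∷ β) ∷ ((c ∷ γ) ∷ T)) eq ((_ , _ , s) , iT) =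
  subst (Strip β) (trans (cong top (sym (shift-unshift ((c ∷ γ) ∷ T) (cong Vec.tail eq))))
                         (top-shift (unshift ((c ∷ γ) ∷ T)))) s ,
  interlacing-unshift ((c ∷ γ) ∷ T) (cong Vec.tail eq) iT

-- Chains of horizontal strips on top of a tableau

chainRows : ∀ {n m} → ℕ → Rows n → Vec (Vec ℕ n) m → Rows n
chainRows         L ws []       = ws
-- The head is the outermost strip. With `m` strips inside it and letters counted from 0, it holds
-- the letter `L + m`, whose variable is the power of q with exponent `suc m`.
chainRows {m = suc m} L ws (β ∷ βs) = addLetter (L + m) β (chainRows L ws βs)

rowsChain : ∀ {n} (L m : ℕ) → Rows n → Rows n × Vec (Vec ℕ n) m
rowsChain L zero    ws = ws , []
rowsChain L (suc m) ws = let vs , βs = rowsChain L m (cutLetter (L + m) ws) in vs , lengths ws ∷ βs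

module _ {n L} (T : Tri n) (ws : Rows n) (len : lengths ws ≡ top T) (t : Tableau L ws) where

  tableau-chainRows : ∀ {m} (βs : Vec (Vec ℕ n) m) → StripChain T βs →
    Tableau (L + m) (chainRows L ws βs) × lengths (chainRows L ws βs) ≡ outer T βs
  tableau-chainRows [] _ = subst (λ l → Tableau l ws) (sym (+-identityʳ L)) t , len
  tableau-chainRows {suc m} (β ∷ βs) (s , sc) =
    let t′ , len′ = tableau-chainRows βs sc
        s′ = subst (Strip β) (sym len′) s
    in subst (λ l → Tableau l (addLetter (L + m) β (chainRows L ws βs))) (sym (+-suc L m)) (tableau-addLetter (L + m) β (chainRows L ws βs) t′ s′)
     , lengths-addLetter (L + m) β (chainRows L ws βs) s′

  rowsChain-chainRows : ∀ {m} (βs : Vec (Vec ℕ n) m) → StripChain T βs →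
    rowsChain L m (chainRows L ws βs) ≡ (ws , βs)
  rowsChain-chainRows [] _ = refl
  rowsChain-chainRows {suc m} (β ∷ βs) sc@(_ , sc′) = cong₂ (λ (vs , γs) γ → vs , γ ∷ γs)
    (trans (cong (rowsChain L m)
                 (cutLetter-addLetter (L + m) β (chainRows L ws βs) (proj₁ (tableau-chainRows βs sc′))))
           (rowsChain-chainRows βs sc′))
    (proj₂ (tableau-chainRows (β ∷ βs) sc))

tableau-rowsChain : ∀ {n} L m (ws : Rows n) → Tableau (L + m) ws → Tableau L (proj₁ (rowsChain L m ws))
tableau-rowsChain L zero    ws t = subst (λ l → Tableau l ws) (+-identityʳ L) t
tableau-rowsChain L (suc m) ws t =
  tableau-rowsChain L m _ (tableau-cutLetter (L + m) ws (subst (λ l → Tableau l ws) (+-suc L m) t))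

module _ {n} (T : Tri n) where

  strips-rowsChain : ∀ L m (ws : Rows n) → lengths (proj₁ (rowsChain L m ws)) ≡ top T →
    Tableau (L + m) ws → let βs = proj₂ (rowsChain L m ws) in
    StripChain T βs × outer T βs ≡ lengths ws
  strips-rowsChain L zero    ws len t = tt , sym len
  strips-rowsChain L (suc m) ws len t =
    let t′ = subst (λ l → Tableau l ws) (+-suc L m) t
        sc , out = strips-rowsChain L m (cutLetter (L + m) ws) len (tableau-cutLetter (L + m) ws t′)
    in (subst (Strip (lengths ws)) (sym out) (strip-cutLetter (L + m) ws t′) , sc) , refl

chainRows-rowsChain : ∀ {n} L m (ws : Rows n) → Tableau (L + m) ws →
  let vs , βs = rowsChain L m ws in chainRows L vs βs ≡ ws
chainRows-rowsChain L zero    ws t = refl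
chainRows-rowsChain L (suc m) ws t =
  let t′ = subst (λ l → Tableau l ws) (+-suc L m) t in
  trans (cong (addLetter (L + m) (lengths ws))
              (chainRows-rowsChain L m (cutLetter (L + m) ws) (tableau-cutLetter (L + m) ws t′)))
        (addLetter-cutLetter (L + m) ws t′)

-- The exponent of q: truncation gives 0 to the letters below `L`, whose variables are 1, and the
-- letter `L + j` gets `suc j`.
wordWeight : ℕ → List ℕ → ℕ
wordWeight L w = ℕ.sum (List.map (λ a → suc a ∸ L) w)

rowsWeight : ∀ {n} → ℕ → Rows n → ℕ
rowsWeight L ws = sum (Vec.map (wordWeight L) ws)

wordWeight-++ : ∀ L w a n → wordWeight L (w List.++ replicate n a) ≡ wordWeight L w + n * (suc a ∸ L)
wordWeight-++ L w a n = begin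
  ℕ.sum (List.map f (w List.++ replicate n a))                ≡⟨ cong ℕ.sum (List.map-++ f w _) ⟩
  ℕ.sum (List.map f w List.++ List.map f (replicate n a))     ≡⟨ ℕ.sum-++ (List.map f w) _ ⟩
  wordWeight L w + ℕ.sum (List.map f (replicate n a))    ≡⟨ cong (wordWeight L w +_) (sum-replicate n) ⟩
  wordWeight L w + n * f a                               ∎
  where
  open ≡-Reasoning
  f : ℕ → ℕ
  f a = suc a ∸ L
  sum-replicate : ∀ n → ℕ.sum (List.map f (replicate n a)) ≡ n * f a
  sum-replicate zero    = refl
  sum-replicate (suc n) = cong (f a +_) (sum-replicate n)

-- `D` is the number of added cells. As a witness with an additive equation it keeps the truncated
-- difference of `stripWeight` out of the induction.
rowsWeight-addLetter : ∀ {n} L a (β : Vec ℕ n) ws → Strip β (lengths ws) →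
  ∃ λ D → sum β ≡ sum (lengths ws) + D ×
          rowsWeight L (addLetter a β ws) ≡ rowsWeight L ws + D * (suc a ∸ L)
rowsWeight-addLetter L a []      []       _           = 0 , refl , refl
rowsWeight-addLetter L a (l ∷ β) (w ∷ ws) (w≤l , _ , s) =
  let D , eq₁ , eq₂ = rowsWeight-addLetter L a β ws s
      d = l ∸ length w
  in d + D
   , trans (cong₂ _+_ (sym (m+[n∸m]≡n w≤l)) eq₁) (shuffle₁ (length w) d (sum (lengths ws)) D)
   , trans (cong₂ _+_ (wordWeight-++ L w a d) eq₂)
           (shuffle₂ (wordWeight L w) d (suc a ∸ L) (rowsWeight L ws) D)
  where
  shuffle₁ : ∀ w d W D → (w + d) + (W + D) ≡ (w + W) + (d + D)
  shuffle₁ = solve-∀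
  shuffle₂ : ∀ w d c W D → (w + d * c) + (W + D * c) ≡ (w + W) + (d + D) * c
  shuffle₂ = solve-∀

wordWeight-small : ∀ {L w} → All (_< L) w → wordWeight L w ≡ 0
wordWeight-small []        = refl
wordWeight-small (a<L ∷ b) = cong₂ _+_ (m≤n⇒m∸n≡0 a<L) (wordWeight-small b)

rowsWeight-small : ∀ {n L} (ws : Rows n) → Tableau L ws → rowsWeight L ws ≡ 0
rowsWeight-small []       _               = refl
rowsWeight-small (w ∷ ws) (_ , b , _ , t) = cong₂ _+_ (wordWeight-small b) (rowsWeight-small ws t)

rowsWeight-chainRows : ∀ {n m L} (T : Tri n) (ws : Rows n) → lengths ws ≡ top T → Tableau L ws →
  (βs : Vec (Vec ℕ n) m) → StripChain T βs → rowsWeight L (chainRows L ws βs) ≡ stripWeight T βs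
rowsWeight-chainRows T ws len t [] _ = rowsWeight-small ws t
rowsWeight-chainRows {m = suc m} {L} T ws len t (β ∷ βs) (s , sc) =
  let len′ = proj₂ (tableau-chainRows T ws len t βs sc)
      D , eq₁ , eq₂ = rowsWeight-addLetter L (L + m) β (chainRows L ws βs) (subst (Strip β) (sym len′) s)
  in begin
    rowsWeight L (addLetter (L + m) β (chainRows L ws βs))            ≡⟨ eq₂ ⟩
    rowsWeight L (chainRows L ws βs) + D * (suc (L + m) ∸ L)          ≡⟨ +-comm (rowsWeight L (chainRows L ws βs)) _ ⟩
    D * (suc (L + m) ∸ L) + rowsWeight L (chainRows L ws βs)
      ≡⟨ cong₂ _+_
           (trans (cong₂ _*_ (trans (sym (m+n∸m≡n (sum (lengths (chainRows L ws βs))) D)) (cong₂ _∸_ (sym eq₁) (cong sum len′)))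
                             (trans (cong (_∸ L) (sym (+-suc L m))) (m+n∸m≡n L (suc m))))
                  (*-comm (sum β ∸ sum (outer T βs)) (suc m)))
           (rowsWeight-chainRows T ws len t βs sc) ⟩
    suc m * (sum β ∸ sum (outer T βs)) + stripWeight T βs ∎
  where open ≡-Reasoning

-- Weighted bijections

-- The maps act on the ambient types and are constrained only on the two subsets. Elements carry no
-- proofs, so the inverse laws are plain equations of data.
record Bijection {A B : Set} (P : A → Set) (Q : B → Set) (v : A → ℕ) (w : B → ℕ) : Set where
  field
    to      : A → B
    from    : B → A
    to-∈    : ∀ {a} → P a → Q (to a)
    from-∈  : ∀ {b} → Q b → P (from b)
    from∘to : ∀ {a} → P a → from (to a) ≡ a
    to∘from : ∀ {b} → Q b → to (from b) ≡ b
    weight  : ∀ {a} → P a → w (to a) ≡ v a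

_∙_ : ∀ {A B C : Set} {P : A → Set} {Q : B → Set} {R : C → Set} {u v w} →
  Bijection P Q u v → Bijection Q R v w → Bijection P R u w
f ∙ g = record
  { to      = λ a → G.to (F.to a)
  ; from    = λ c → F.from (G.from c)
  ; to-∈    = λ p → G.to-∈ (F.to-∈ p)
  ; from-∈  = λ r → F.from-∈ (G.from-∈ r)
  ; from∘to = λ p → trans (cong F.from (G.from∘to (F.to-∈ p))) (F.from∘to p)
  ; to∘from = λ r → trans (cong G.to (F.to∘from (G.from-∈ r))) (G.to∘from r)
  ; weight  = λ p → trans (G.weight (F.to-∈ p)) (F.weight p)
  }
  where
  module F = Bijection f
  module G = Bijection g

-- L is the number of variables set to 1 and V restricts the edge: not at all for
-- the first identity, to 0 for the second.
record Base (n L : ℕ) (V : Vec ℕ n → Set) : Set where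
  field
    bijection : Bijection (λ T → Interlacing T × V (edge T)) (Tableau {n} L) (λ _ → 0) (λ _ → 0)
  open Bijection bijection public
  field
    lengths-to : ∀ {T} → Interlacing T × V (edge T) → lengths (to T) ≡ top T

base-any : ∀ n → Base n n (λ _ → ⊤)
base-any n = record
  { bijection = record
    { to      = triRows
    ; from    = rowsTri
    ; to-∈    = λ {T} (iT , _) → tableau-triRows T iT
    ; from-∈  = λ {ws} t → interlacing-rowsTri ws t , tt
    ; from∘to = λ {T} (iT , _) → rowsTri-triRows T iT
    ; to∘from = λ {ws} → triRows-rowsTri ws
    ; weight  = λ _ → refl
    }
  ; lengths-to = λ {T} (iT , _) → lengths-triRows T iT
  }

base-zero : ∀ n → Base (suc n) n (_≡ Vec.replicate (suc n) 0)
base-zero n = record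
  { bijection = record
    { to      = λ T → [] ∷ triRows (unshift T)
    ; from    = λ ws → shift (rowsTri (Vec.tail ws))
    ; to-∈    = λ {T} (iT , z) → tableau-∷[] _ (tableau-triRows (unshift T) (interlacing-unshift T z iT))
    ; from-∈  = λ { {w ∷ ws} (_ , _ , _ , t) → interlacing-shift _ (interlacing-rowsTri ws t) , edge-shift _ }
    ; from∘to = λ {T} (iT , z) → trans (cong shift (rowsTri-triRows (unshift T) (interlacing-unshift T z iT)))
                                       (shift-unshift T z)
    ; to∘from = λ { {w ∷ ws} t → cong₂ _∷_ (sym (bottom-empty w ws t))
                    (trans (cong triRows (unshift-shift (rowsTri ws)))
                           (triRows-rowsTri ws (proj₂ (proj₂ (proj₂ t))))) }
    ; weight  = λ _ → refl
    }
  ; lengths-to = λ {T} (iT , z) →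
      trans (cong (0 ∷_) (lengths-triRows (unshift T) (interlacing-unshift T z iT)))
            (trans (sym (top-shift (unshift T))) (cong top (shift-unshift T z)))
  }

-- The correspondence for rectangular shapes

module _ {n L : ℕ} {V : Vec ℕ n → Set} (B : Base n L V) (k m : ℕ) where
  private
    module B = Base B
    K = Vec.replicate n k
    T₀ = constant-tri n k

    chain₀ : ∀ {Es : Vec (Vec ℕ n) m} → EdgeChain K Es → EdgeChain (edge T₀) Es
    chain₀ {Es} = subst (λ v → EdgeChain v Es) (sym (edge-constant n k))

    iT₀ = interlacing-constant n k

  -- The edge of the constant triangle is the complement of the zero column of the level beyond `m`,
  -- so it is the right start for the chain of columns. Backwards the triangle given by `unrsk` can
  -- be forgotten, since `tri-constant` says that it is `T₀`.
  edges-rsk : Bijection (λ Es → EdgeChain K Es × V (lastFrom K Es))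
                        (λ ((T , βs) : Tri n × Vec (Vec ℕ n) m) →
                           (Interlacing T × V (edge T)) × StripChain T βs × outer T βs ≡ K)
                        (edgeWeight K) (λ (T , βs) → stripWeight T βs)
  edges-rsk = record
    { to      = rsk T₀
    ; from    = λ (T , βs) → proj₂ (unrsk T βs)
    ; to-∈    = λ {Es} (ec , v) → let iT , sc = rsk-strips T₀ Es iT₀ (chain₀ ec) in
        (iT , subst V (sym (trans (edge-rsk T₀ Es) (cong (λ e → lastFrom e Es) (edge-constant n k)))) v)
        , sc , trans (outer-rsk T₀ Es) (top-constant n k)
    ; from-∈  = λ {(T , βs)} ((iT , v) , sc , out) →
        let iT′ , ec = unrsk-edges T βs iT sc
            eq = trans (cong edge (tri-constant n k _ iT′ (trans (top-unrsk T βs) out))) (edge-constant n k)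
        in subst (λ e → EdgeChain e (proj₂ (unrsk T βs))) eq ec
         , subst V (trans (sym (lastFrom-unrsk T βs)) (cong (λ e → lastFrom e (proj₂ (unrsk T βs))) eq)) v
    ; from∘to = λ {Es} (ec , _) → cong proj₂ (unrsk-rsk T₀ Es iT₀ (chain₀ ec))
    ; to∘from = λ {(T , βs)} ((iT , _) , sc , out) → trans
        (cong (λ T′ → rsk T′ (proj₂ (unrsk T βs)))
              (sym (tri-constant n k _ (proj₁ (unrsk-edges T βs iT sc)) (trans (top-unrsk T βs) out))))
        (rsk-unrsk T βs iT sc)
    ; weight  = λ {Es} (ec , _) → trans (rsk-weight T₀ Es iT₀ (chain₀ ec))
                                        (cong (λ v → edgeWeight v Es) (edge-constant n k))
    }

  strips-tableau : Bijection (λ ((T , βs) : Tri n × Vec (Vec ℕ n) m) →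
                                (Interlacing T × V (edge T)) × StripChain T βs × outer T βs ≡ K)
                             (λ ws → Tableau (L + m) ws × lengths ws ≡ K)
                             (λ (T , βs) → stripWeight T βs) (rowsWeight L)
  strips-tableau = record
    { to      = λ (T , βs) → chainRows L (B.to T) βs
    ; from    = λ ws → let vs , βs = rowsChain L m ws in B.from vs , βs
    ; to-∈    = λ {(T , βs)} (iT , sc , out) →
        let t , len = tableau-chainRows T (B.to T) (B.lengths-to iT) (B.to-∈ iT) βs sc in
        t , trans len out
    ; from-∈  = λ {ws} (t , len) →
        let t′ = tableau-rowsChain L m ws t
            iT = B.from-∈ t′
            sc , out = strips-rowsChain (B.from (proj₁ (rowsChain L m ws))) L m ws
                         (trans (cong lengths (sym (B.to∘from t′))) (B.lengths-to iT)) t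
        in iT , sc , trans out len
    ; from∘to = λ {(T , βs)} (iT , sc , _) → trans
        (cong (λ (vs , βs) → B.from vs , βs)
              (rowsChain-chainRows T (B.to T) (B.lengths-to iT) (B.to-∈ iT) βs sc))
        (cong (_, βs) (B.from∘to iT))
    ; to∘from = λ {ws} (t , _) → trans
        (cong (λ vs → chainRows L vs (proj₂ (rowsChain L m ws))) (B.to∘from (tableau-rowsChain L m ws t)))
        (chainRows-rowsChain L m ws t)
    ; weight  = λ {(T , βs)} (iT , sc , _) →
        rowsWeight-chainRows T (B.to T) (B.lengths-to iT) (B.to-∈ iT) βs sc
    }

-- Tableaux as fillings

∈-words⁺ : ∀ {r l} (w : List (Fin r)) → length w ≡ l → w ∈ words r l
∈-words⁺ []      refl = here refl
∈-words⁺ (a ∷ w) refl = ∈-cartesianProductWith⁺ _∷_ (∈-allFin a) (∈-words⁺ w refl)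

∈-words⁻ : ∀ {r} l {w : List (Fin r)} → w ∈ words r l → length w ≡ l
∈-words⁻ zero    (here refl) = refl
∈-words⁻ {r} (suc l) w∈
  with _ , _ , _ , w′∈ , refl ← ∈-cartesianProductWith⁻ _∷_ (allFin r) (words r l) w∈ =
  cong suc (∈-words⁻ l w′∈)

unique-words : ∀ r l → Unique (words r l)
unique-words r zero    = [] ∷ []
unique-words r (suc l) =
  Unique.cartesianProductWith⁺ _∷_ ∷-injective (Unique.allFin⁺ r) (unique-words r l)

∈-fillings⁺ : ∀ {r} n k (T : Filling r) → length T ≡ n → All (λ w → length w ≡ k) T →
  T ∈ fillings r (replicate n k)
∈-fillings⁺ .0 k []      refl _        = here refl
∈-fillings⁺ ._ k (w ∷ T) refl (l ∷ ls) =
  ∈-cartesianProductWith⁺ _∷_ (∈-words⁺ w l) (∈-fillings⁺ (length T) k T refl ls)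

∈-fillings⁻ : ∀ {r} n k {T : Filling r} → T ∈ fillings r (replicate n k) →
  length T ≡ n × All (λ w → length w ≡ k) T
∈-fillings⁻ zero    k (here refl) = refl , []
∈-fillings⁻ {r} (suc n) k T∈
  with _ , _ , w∈ , T′∈ , refl ← ∈-cartesianProductWith⁻ _∷_ (words r k) (fillings r (replicate n k)) T∈ =
  map (cong suc) (∈-words⁻ k w∈ ∷_) (∈-fillings⁻ n k T′∈)

unique-fillings : ∀ r ρ → Unique (fillings r ρ)
unique-fillings r []      = [] ∷ []
unique-fillings r (l ∷ ρ) =
  Unique.cartesianProductWith⁺ _∷_ ∷-injective (unique-words r l) (unique-fillings r ρ)

linked-reverse : ∀ {A : Set} {R : Rel A 0ℓ} {xs} → Linked R xs → Linked (flip R) (reverse xs)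
linked-reverse []           = []
linked-reverse {R = R} l@[-]     = [-]
linked-reverse {R = R} (r ∷ l) = go l (r ∷ [-])
  where
  go : ∀ {x xs acc} → Linked R (x ∷ xs) → Linked (flip R) (x ∷ acc) →
       Linked (flip R) (List.reverseAcc (x ∷ acc) xs)
  go [-]     a = a
  go (r ∷ l) a = go l (r ∷ a)

-- Lists that are too short are filled up with empty rows, too long ones truncated.
resize : ∀ n → List (List ℕ) → Rows n
resize zero    _       = []
resize (suc n) []      = [] ∷ resize n []
resize (suc n) (u ∷ U) = u ∷ resize n U

toList-resize : ∀ n U → length U ≡ n → toList (resize n U) ≡ U
toList-resize .0 []      refl = refl
toList-resize ._ (u ∷ U) refl = cong (u ∷_) (toList-resize _ U refl)

resize-toList : ∀ {n} (ws : Rows n) → resize n (toList ws) ≡ ws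
resize-toList []       = refl
resize-toList (w ∷ ws) = cong (w ∷_) (resize-toList ws)

length-toList : ∀ {n} (ws : Rows n) → length (toList ws) ≡ n
length-toList []       = refl
length-toList (w ∷ ws) = cong suc (length-toList ws)

tableau⁺ : ∀ {L} {n} (ws : Rows n) → All Increasing (toList ws) → All (All (_< L)) (toList ws) →
  Linked (Prefix _>_) (toList ws) → Tableau L ws
tableau⁺ []           _        _        _       = tt
tableau⁺ (w ∷ [])     (i ∷ _)  (b ∷ _)  _       = i , b , tt , tt
tableau⁺ (w ∷ v ∷ ws) (i ∷ is) (b ∷ bs) (p ∷ l) = i , b , p , tableau⁺ (v ∷ ws) is bs l

tableau⁻ : ∀ {L} {n} (ws : Rows n) → Tableau L ws →
  All Increasing (toList ws) × All (All (_< L)) (toList ws) × Linked (Prefix _>_) (toList ws)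
tableau⁻ []           _               = [] , [] , []
tableau⁻ (w ∷ [])     (i , b , _)     = i ∷ [] , b ∷ [] , [-]
tableau⁻ (w ∷ v ∷ ws) (i , b , p , t) =
  let is , bs , l = tableau⁻ (v ∷ ws) t in i ∷ is , b ∷ bs , p ∷ l

lengths⁺ : ∀ {n} k (ws : Rows n) → All (λ w → length w ≡ k) (toList ws) → lengths ws ≡ Vec.replicate n k
lengths⁺ k []       _        = refl
lengths⁺ k (w ∷ ws) (l ∷ ls) = cong₂ _∷_ l (lengths⁺ k ws ls)

lengths⁻ : ∀ {n} k (ws : Rows n) → lengths ws ≡ Vec.replicate n k → All (λ w → length w ≡ k) (toList ws)
lengths⁻ k []       _  = []
lengths⁻ k (w ∷ ws) eq = cong Vec.head eq ∷ lengths⁻ k ws (cong Vec.tail eq)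

letters : ∀ {r} → Filling r → List (List ℕ)
letters = List.map (List.map toℕ)

fillingWeight : ∀ {r} → ℕ → Filling r → ℕ
fillingWeight L T = ℕ.sum (List.map (λ a → suc (toℕ a) ∸ L) (concat T))

sum-map-concat : ∀ {r} L (T : Filling r) →
  fillingWeight L T ≡ ℕ.sum (List.map (wordWeight L) (letters T))
sum-map-concat L []      = refl
sum-map-concat L (w ∷ T) = begin
  ℕ.sum (List.map f (w List.++ concat T))                   ≡⟨ cong ℕ.sum (map-++ f w _) ⟩
  ℕ.sum (List.map f w List.++ List.map f (concat T))        ≡⟨ ℕ.sum-++ (List.map f w) _ ⟩
  ℕ.sum (List.map f w) + fillingWeight L T             ≡⟨ cong₂ _+_ (cong ℕ.sum (map-∘ w)) (sum-map-concat L T) ⟩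
  wordWeight L (List.map toℕ w) + ℕ.sum (List.map (wordWeight L) (letters T)) ∎
  where
  open ≡-Reasoning
  f = λ a → suc (toℕ a) ∸ L

rowsWeight-toList : ∀ {n} L (ws : Rows n) →
  rowsWeight L ws ≡ ℕ.sum (List.map (wordWeight L) (toList ws))
rowsWeight-toList L []       = refl
rowsWeight-toList L (w ∷ ws) = cong (wordWeight L w +_) (rowsWeight-toList L ws)

semistandard⁺ : ∀ {r} {T : Filling r} → All Increasing (letters T) →
  Linked (flip (Prefix _>_)) (letters T) → Semistandard T
semistandard⁺ i l =
  All.map Linked.map⁻ (All.map⁻ i) , Linked.map (Prefix.map⁻ toℕ toℕ) (Linked.map⁻ l)

semistandard⁻ : ∀ {r} {T : Filling r} → Semistandard T →
  All Increasing (letters T) × Linked (flip (Prefix _>_)) (letters T)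
semistandard⁻ (i , l) =
  All.map⁺ (All.map Linked.map⁺ i) , Linked.map⁺ (Linked.map (Prefix.map⁺ toℕ toℕ) l)

module _ {r : ℕ} (a₀ : Fin r) (L n k : ℕ) where

  -- a₀ is only used for numbers which are not letters.
  letter : ℕ → Fin r
  letter a with a <? r
  ... | yes a<r = fromℕ< a<r
  ... | no  _   = a₀

  letter-toℕ : ∀ i → letter (toℕ i) ≡ i
  letter-toℕ i with toℕ i <? r
  ... | yes a<r = Fin.fromℕ<-toℕ i a<r
  ... | no  a≮r = contradiction (Fin.toℕ<n i) a≮r

  toℕ-letter : ∀ {a} → a < r → toℕ (letter a) ≡ a
  toℕ-letter {a} a<r with a <? r
  ... | yes p   = Fin.toℕ-fromℕ< p
  ... | no  a≮r = contradiction a<r a≮r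

  toFilling : Rows n → Filling r
  toFilling ws = List.map (List.map letter) (reverse (toList ws))

  fromFilling : Filling r → Rows n
  fromFilling T = resize n (reverse (letters T))

  letters-toFilling : ∀ ws → All (All (_< r)) (toList ws) →
    letters (toFilling ws) ≡ reverse (toList ws)
  letters-toFilling ws b = trans (sym (map-∘ (reverse (toList ws)))) (map-id-local
    (All.map (λ {w} w<r → trans (sym (map-∘ w)) (map-id-local (All.map toℕ-letter w<r)))
             (All-resp-↭ (↭-sym (↭-reverse (toList ws))) b)))

  map-letter-letters : ∀ T → List.map (List.map letter) (letters T) ≡ T
  map-letter-letters T = trans (sym (map-∘ T)) (map-id-local
    (All.universal (λ w → trans (sym (map-∘ w)) (map-id-local (All.universal letter-toℕ w))) T))

  toList-fromFilling : ∀ T → length T ≡ n → toList (fromFilling T) ≡ reverse (letters T)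
  toList-fromFilling T len = toList-resize n (reverse (letters T))
    (trans (length-reverse (letters T)) (trans (length-map (List.map toℕ) T) len))

  to-tableau : ∀ {T} → T ∈ ssyt r (replicate n k) →
    Tableau r (fromFilling T) × lengths (fromFilling T) ≡ Vec.replicate n k
  to-tableau {T} T∈ =
    let T∈′ , ss = ∈-filter⁻ semistandard? {xs = fillings r (replicate n k)} T∈
        len , ls = ∈-fillings⁻ n k T∈′
        i , l = semistandard⁻ ss
        eq = sym (toList-fromFilling T len)
        ↭ = ↭-sym (↭-reverse (letters T))
    in tableau⁺ (fromFilling T)
         (subst (All Increasing) eq (All-resp-↭ ↭ i))
         (subst (All (All (_< r))) eq (All-resp-↭ ↭
           (All.map⁺ (All.universal (λ w → All.map⁺ (All.universal Fin.toℕ<n w)) T))))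
         (subst (Linked (Prefix _>_)) eq (linked-reverse l))
     , lengths⁺ k (fromFilling T)
         (subst (All (λ w → length w ≡ k)) eq (All-resp-↭ ↭
           (All.map⁺ (All.map (λ {w} → trans (length-map toℕ w)) ls))))

  from-tableau : ∀ {ws} → Tableau r ws × lengths ws ≡ Vec.replicate n k →
    toFilling ws ∈ ssyt r (replicate n k)
  from-tableau {ws} (t , len) =
    let i , b , l = tableau⁻ ws t
        eq = sym (letters-toFilling ws b)
        ↭ = ↭-sym (↭-reverse (toList ws))
    in ∈-filter⁺ semistandard?
         (∈-fillings⁺ n k (toFilling ws)
           (trans (length-map (List.map letter) (reverse (toList ws)))
             (trans (length-reverse (toList ws)) (length-toList ws)))
           (All.map⁺ (All.map (λ {w} → trans (length-map letter w))
             (All-resp-↭ ↭ (lengths⁻ k ws len)))))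
         (semistandard⁺ (subst (All Increasing) eq (All-resp-↭ ↭ i))
                        (subst (Linked (flip (Prefix _>_))) eq (linked-reverse l)))

  -- Fillings list their rows from the top and `Rows` from the bottom, hence the reversals on both
  -- sides.
  tableau-filling : Bijection (λ ws → Tableau r ws × lengths ws ≡ Vec.replicate n k)
                              (_∈ ssyt r (replicate n k)) (rowsWeight L) (fillingWeight L)
  tableau-filling = record
    { to      = toFilling
    ; from    = fromFilling
    ; to-∈    = from-tableau
    ; from-∈  = to-tableau
    ; from∘to = λ {ws} (t , _) → begin
        resize n (reverse (letters (toFilling ws)))  ≡⟨ cong (resize n ∘ reverse) (letters-toFilling ws (proj₁ (proj₂ (tableau⁻ ws t)))) ⟩
        resize n (reverse (reverse (toList ws)))     ≡⟨ cong (resize n) (reverse-involutive (toList ws)) ⟩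
        resize n (toList ws)                         ≡⟨ resize-toList ws ⟩
        ws                                           ∎
    ; to∘from = λ {T} T∈ →
        let T∈′ , _ = ∈-filter⁻ semistandard? {xs = fillings r (replicate n k)} T∈ in begin
        List.map (List.map letter) (reverse (toList (fromFilling T)))  ≡⟨ cong (List.map (List.map letter) ∘ reverse) (toList-fromFilling T (proj₁ (∈-fillings⁻ n k T∈′))) ⟩
        List.map (List.map letter) (reverse (reverse (letters T)))     ≡⟨ cong (List.map (List.map letter)) (reverse-involutive (letters T)) ⟩
        List.map (List.map letter) (letters T)                         ≡⟨ map-letter-letters T ⟩
        T                                                              ∎
    ; weight  = λ {ws} (t , _) → begin
        fillingWeight L (toFilling ws)                                    ≡⟨ sum-map-concat L (toFilling ws) ⟩
        ℕ.sum (List.map (wordWeight L) (letters (toFilling ws)))          ≡⟨ cong (ℕ.sum ∘ List.map (wordWeight L)) (letters-toFilling ws (proj₁ (proj₂ (tableau⁻ ws t)))) ⟩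
        ℕ.sum (List.map (wordWeight L) (reverse (toList ws)))             ≡⟨ ℕ.sum-↭ (map⁺ (wordWeight L) (↭-reverse (toList ws))) ⟩
        ℕ.sum (List.map (wordWeight L) (toList ws))                       ≡⟨ rowsWeight-toList L ws ⟨
        rowsWeight L ws                                                   ∎
    }
    where open ≡-Reasoning

-- Power series that count

-- Lists without repetition instead of mere cardinalities: a position in `list d` becomes the
-- element of `Fin N` that is assigned to a plane partition of corner volume `d`.
record Enumeration {X : Set} (P : X → Set) (w : X → ℕ) : Set where
  field
    list     : ℕ → List X
    unique   : ∀ d → Unique (list d)
    sound    : ∀ {d x} → x ∈ list d → P x × w x ≡ d
    complete : ∀ {x} → P x → x ∈ list (w x)

  Counts : PowerSeries → Set
  Counts F = ∀ d → F d ≡ ℤ.+ length (list d)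

open Enumeration

enumerate-filter : ∀ {X : Set} {xs : List X} → Unique xs → (w : X → ℕ) → Enumeration (_∈ xs) w
enumerate-filter {xs = xs} u w = record
  { list     = λ d → filter (λ x → w x ≟ d) xs
  ; unique   = λ d → Unique.filter⁺ (λ x → w x ≟ d) u
  ; sound    = λ {d} → ∈-filter⁻ (λ x → w x ≟ d)
  ; complete = λ {x} x∈ → ∈-filter⁺ (λ y → w y ≟ w x) x∈ refl
  }

sumℤ-+ : ∀ {n} (f g : ℕ → ℤ) →
  sumℤ {n} (λ i → f (toℕ i) ℤ.+ g (toℕ i)) ≡ sumℤ {n} (f ∘ toℕ) ℤ.+ sumℤ {n} (g ∘ toℕ)
sumℤ-+ {n} f g = ∑-distrib-+ {n} (f ∘ toℕ) (g ∘ toℕ)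

sumℤ-neg : ∀ {n} (f : ℕ → ℤ) → sumℤ {n} (λ i → ℤ.- f (toℕ i)) ≡ ℤ.- sumℤ {n} (f ∘ toℕ)
sumℤ-neg {zero}  f = refl
sumℤ-neg {suc n} f = trans (cong (λ z → ℤ.- f 0 ℤ.+ z) (sumℤ-neg {n} (f ∘ suc)))
                           (sym (ℤ.neg-distrib-+ (f 0) _))

-- The power of q with exponent `a`, by recursion on exponent and degree together, so that lowering
-- both by one is a definitional equality.
monomial : ℕ → PowerSeries
monomial zero    zero    = 1ℤ
monomial zero    (suc d) = 0ℤ
monomial (suc a) zero    = 0ℤ
monomial (suc a) (suc d) = monomial a d

-- Picking one term out of a sum of `n` terms. The value 0 for an index out of range lets
-- `geometric-recurrence` hold uniformly in all degrees.
select : ℕ → ℕ → (ℕ → ℤ) → ℤ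
select zero    a       h = 0ℤ
select (suc n) zero    h = h 0
select (suc n) (suc a) h = select n a (h ∘ suc)

sumℤ-zero : ∀ n {f : ℕ → ℤ} → (∀ i → f i ≡ 0ℤ) → sumℤ {n} (f ∘ toℕ) ≡ 0ℤ
sumℤ-zero zero    f≗0 = refl
sumℤ-zero (suc n) f≗0 = cong₂ ℤ._+_ (f≗0 0) (sumℤ-zero n (f≗0 ∘ suc))

sumℤ-monomial : ∀ n a h → sumℤ {n} (λ i → monomial a (toℕ i) ℤ.* h (toℕ i)) ≡ select n a h
sumℤ-monomial zero    a       h = refl
sumℤ-monomial (suc n) zero    h = trans
  (cong₂ ℤ._+_ (ℤ.*-identityˡ (h 0)) (sumℤ-zero n (λ i → ℤ.*-zeroˡ (h (suc i)))))
  (ℤ.+-identityʳ (h 0))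
sumℤ-monomial (suc n) (suc a) h = trans
  (cong₂ ℤ._+_ (ℤ.*-zeroˡ (h 0)) (sumℤ-monomial n a (h ∘ suc)))
  (ℤ.+-identityˡ _)

⊛-cong : ∀ {f f′ g g′ : PowerSeries} → (∀ d → f d ≡ f′ d) → (∀ d → g d ≡ g′ d) →
  ∀ d → (f ⊛ g) d ≡ (f′ ⊛ g′) d
⊛-cong f≗ g≗ d = sumℤ-cong {suc d} (λ i → cong₂ ℤ._*_ (f≗ (toℕ i)) (g≗ (d ∸ toℕ i)))

select-monomial : ∀ a b d → select (suc d) a (λ i → monomial b (d ∸ i)) ≡ monomial (a + b) d
select-monomial zero    b d       = refl
select-monomial (suc a) b zero    = refl
select-monomial (suc a) b (suc d) = select-monomial a b d

monomial-⊛ : ∀ a b d → (monomial a ⊛ monomial b) d ≡ monomial (a + b) d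
monomial-⊛ a b d = trans (sumℤ-monomial (suc d) a (λ i → monomial b (d ∸ i))) (select-monomial a b d)

1#≈monomial : ∀ d → 1# d ≡ monomial 0 d
1#≈monomial zero    = refl
1#≈monomial (suc d) = refl

q≈monomial : ∀ d → q d ≡ monomial 1 d
q≈monomial 0             = refl
q≈monomial 1             = refl
q≈monomial (suc (suc d)) = refl

q^≈monomial : ∀ a d → (q ⊛^ a) d ≡ monomial a d
q^≈monomial zero    d = 1#≈monomial d
q^≈monomial (suc a) d = trans (⊛-cong q≈monomial (q^≈monomial a) d) (monomial-⊛ 1 a d)

word-monomial : ∀ {r} (x : Vector PowerSeries r) (w : Fin r → ℕ) →
  (∀ i d → x i d ≡ monomial (w i) d) → ∀ u d →
  List.foldr _⊛_ 1# (List.map x u) d ≡ monomial (ℕ.sum (List.map w u)) d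
word-monomial x w x≈ []      d = 1#≈monomial d
word-monomial x w x≈ (i ∷ u) d =
  trans (⊛-cong (x≈ i) (word-monomial x w x≈ u) d) (monomial-⊛ (w i) _ d)

monomial-diagonal : ∀ d → monomial d d ≡ 1ℤ
monomial-diagonal zero    = refl
monomial-diagonal (suc d) = monomial-diagonal d

monomial-off : ∀ {a d} → a ≢ d → monomial a d ≡ 0ℤ
monomial-off {zero}  {zero}  a≢d = contradiction refl a≢d
monomial-off {zero}  {suc d} a≢d = refl
monomial-off {suc a} {zero}  a≢d = refl
monomial-off {suc a} {suc d} a≢d = monomial-off (a≢d ∘ cong suc)

0#≈0 : ∀ d → 0# d ≡ 0ℤ
0#≈0 zero    = refl
0#≈0 (suc d) = refl

sum-monomials : ∀ {X : Set} (F : X → PowerSeries) (w : X → ℕ) →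
  (∀ x d → F x d ≡ monomial (w x) d) → ∀ xs d →
  List.foldr _⊕_ 0# (List.map F xs) d ≡ ℤ.+ length (filter (λ x → w x ≟ d) xs)
sum-monomials F w F≈ []       d = 0#≈0 d
sum-monomials F w F≈ (x ∷ xs) d with w x ≟ d
... | yes p  rewrite filter-accept (λ x → w x ≟ d) {xs = xs} p = cong₂ ℤ._+_
  (trans (F≈ x d) (trans (cong (λ a → monomial a d) p) (monomial-diagonal d)))
  (sum-monomials F w F≈ xs d)
... | no  ¬p rewrite filter-reject (λ x → w x ≟ d) {xs = xs} ¬p = trans (cong₂ ℤ._+_
  (trans (F≈ x d) (monomial-off ¬p))
  (sum-monomials F w F≈ xs d)) (ℤ.+-identityˡ _)

unique-ssyt : ∀ r ρ → Unique (ssyt r ρ)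
unique-ssyt r ρ = Unique.filter⁺ semistandard? (unique-fillings r ρ)

enumerate-ssyt : ∀ L r ρ → Enumeration (_∈ ssyt r ρ) (fillingWeight L)
enumerate-ssyt L r ρ = enumerate-filter (unique-ssyt r ρ) (fillingWeight L)

schur-counts : ∀ L {r} ρ (x : Vector PowerSeries r) →
  (∀ i d → x i d ≡ (q ⊛^ (suc (toℕ i) ∸ L)) d) → Counts (enumerate-ssyt L r ρ) (s ρ x)
schur-counts L {r} ρ x x≈ d = sum-monomials _ (fillingWeight L)
  (λ T → word-monomial x (λ i → suc (toℕ i) ∸ L) (λ i d → trans (x≈ i d) (q^≈monomial (suc (toℕ i) ∸ L) d)) (concat T))
  (ssyt r ρ) d

length-cartesianProductWith : ∀ {X Y Z : Set} (f : X → Y → Z) xs ys →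
  length (cartesianProductWith f xs ys) ≡ length xs * length ys
length-cartesianProductWith f []       ys = refl
length-cartesianProductWith f (x ∷ xs) ys = trans (length-++ (List.map (f x) ys))
  (cong₂ _+_ (length-map (f x) ys) (length-cartesianProductWith f xs ys))

module _ {X Y Z : Set} {u : X → ℕ} {v : Y → ℕ} {w : Z → ℕ}
         (f : X → Y → Z) (f-injective : ∀ {x x′ y y′} → f x y ≡ f x′ y′ → x ≡ x′ × y ≡ y′)
         (f-surjective : ∀ z → ∃₂ λ x y → f x y ≡ z)
         (w∘f : ∀ x y → w (f x y) ≡ u x + v y)
         (E : Enumeration {X} (λ _ → ⊤) u) (E′ : Enumeration {Y} (λ _ → ⊤) v) where
  private
    block : (d : ℕ) → Fin (suc d) → List Z
    block d i = cartesianProductWith f (list E (toℕ i)) (list E′ (d ∸ toℕ i))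

    ∈-block : ∀ {d i z} → z ∈ block d i → ∃₂ λ x y → z ≡ f x y × u x ≡ toℕ i × v y ≡ d ∸ toℕ i
    ∈-block {d} {i} z∈ =
      let x , y , x∈ , y∈ , eq = ∈-cartesianProductWith⁻ f (list E (toℕ i)) (list E′ (d ∸ toℕ i)) z∈
      in x , y , eq , proj₂ (sound E x∈) , proj₂ (sound E′ y∈)

    length-blocks : ∀ n (g : ℕ → ℤ) (b : Fin n → List Z) → (∀ i → ℤ.+ length (b i) ≡ g (toℕ i)) →
      sumℤ {n} (g ∘ toℕ) ≡ ℤ.+ length (concat (tabulate b))
    length-blocks zero    g b eq = refl
    length-blocks (suc n) g b eq = trans
      (cong₂ ℤ._+_ (sym (eq Fin.zero)) (length-blocks n (g ∘ suc) (b ∘ Fin.suc) (eq ∘ Fin.suc)))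
      (cong ℤ.+_ (sym (length-++ (b Fin.zero))))

  convolution : Enumeration {Z} (λ _ → ⊤) w
  convolution = record
    { list     = λ d → concat (tabulate (block d))
    ; unique   = λ d → Unique.concat⁺
        (All.tabulate⁺ {f = block d} λ i → Unique.cartesianProductWith⁺ f f-injective (unique E (toℕ i)) (unique E′ (d ∸ toℕ i)))
        -- Different blocks are disjoint because the index of a block is the weight of the first
        -- component.
        (AllPairs.tabulate⁺ {f = block d} λ {i} {j} i≢j (z∈ , z∈′) →
          let x , y , eq , ux , _ = ∈-block {d} {i} z∈
              x′ , y′ , eq′ , ux′ , _ = ∈-block {d} {j} z∈′
          in i≢j (Fin.toℕ-injective (trans (sym ux)
               (trans (cong u (proj₁ (f-injective (trans (sym eq) eq′)))) ux′))))
    ; sound    = λ {d} z∈ →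
        let b , z∈b , b∈ = ∈-concat⁻′ (tabulate (block d)) z∈
            i , b≡ = ∈-tabulate⁻ {f = block d} b∈
            x , y , eq , ux , vy = ∈-block {d} {i} (subst (_ ∈_) b≡ z∈b)
        in tt , (begin
          w _                    ≡⟨ cong w eq ⟩
          w (f x y)              ≡⟨ w∘f x y ⟩
          u x + v y              ≡⟨ cong₂ _+_ ux vy ⟩
          toℕ i + (d ∸ toℕ i)    ≡⟨ m+[n∸m]≡n (s≤s⁻¹ (Fin.toℕ<n i)) ⟩
          d                      ∎)
    ; complete = λ {z} _ → case (f-surjective z)
    }
    where
    open ≡-Reasoning
    case : ∀ {z} → (∃₂ λ x y → f x y ≡ z) → z ∈ concat (tabulate (block (w z)))
    case (x , y , refl) = ∈-concat⁺′ {xss = tabulate (block (w (f x y)))}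
      (∈-cartesianProductWith⁺ f
        (subst (λ e → x ∈ list E e) (sym i≡) (complete E tt))
        (subst (λ e → y ∈ list E′ e) (sym (trans (cong₂ _∸_ (w∘f x y) i≡) (m+n∸m≡n (u x) (v y)))) (complete E′ tt)))
      (∈-tabulate⁺ {f = block (w (f x y))} i)
      where
      u≤ : u x < suc (w (f x y))
      u≤ = s≤s (subst (u x ≤_) (sym (w∘f x y)) (m≤m+n (u x) (v y)))
      i = Fin.fromℕ< u≤
      i≡ : toℕ i ≡ u x
      i≡ = Fin.toℕ-fromℕ< u≤

  convolution-counts : ∀ {F G} → Counts E F → Counts E′ G → Counts convolution (F ⊛ G)
  convolution-counts {F} {G} cF cG d = length-blocks (suc d) (λ i → F i ℤ.* G (d ∸ i)) (block d)
    (λ i → trans (cong ℤ.+_ (length-cartesianProductWith f (list E (toℕ i)) _))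
      (trans (ℤ.pos-* (length (list E (toℕ i))) (length (list E′ (d ∸ toℕ i))))
        (cong₂ ℤ._*_ (sym (cF (toℕ i))) (sym (cG (d ∸ toℕ i))))))

enumerate-[] : ∀ {X : Set} → Enumeration {Vec X 0} (λ _ → ⊤) (λ _ → 0)
enumerate-[] = record
  { list     = λ { zero → [] ∷ [] ; (suc _) → [] }
  ; unique   = λ { zero → [] ∷ [] ; (suc _) → [] }
  ; sound    = λ { {zero} (here refl) → tt , refl }
  ; complete = λ { {[]} _ → here refl }
  }

1#-counts : ∀ {X : Set} → Counts (enumerate-[] {X}) 1#
1#-counts zero    = refl
1#-counts (suc d) = refl

vecWeight : ∀ {X : Set} {m} → (ℕ → X → ℕ) → Vec X m → ℕ
vecWeight u []       = 0
vecWeight u (x ∷ xs) = u 0 x + vecWeight (u ∘ suc) xs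

module _ {X : Set} where

  enumerate-vec : ∀ m {u : ℕ → X → ℕ} → (∀ j → Enumeration (λ _ → ⊤) (u j)) →
    Enumeration {Vec X m} (λ _ → ⊤) (vecWeight u)
  enumerate-vec zero    E = record
    { list     = list enumerate-[]
    ; unique   = unique enumerate-[]
    ; sound    = λ { {d} {[]} → sound enumerate-[] }
    ; complete = λ { {[]} → complete enumerate-[] }
    }
  enumerate-vec (suc m) E = convolution _∷_ (λ { refl → refl , refl }) (λ { (x ∷ xs) → x , xs , refl })
    (λ _ _ → refl) (E 0) (enumerate-vec m (E ∘ suc))

  product-counts : ∀ m {u : ℕ → X → ℕ} (E : ∀ j → Enumeration (λ _ → ⊤) (u j)) {F : ℕ → PowerSeries} →
    (∀ j → Counts (E j) (F j)) → Counts (enumerate-vec m E) (product {m} (F ∘ toℕ))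
  product-counts zero    E c = 1#-counts {X}
  product-counts (suc m) {u} E c =
    convolution-counts {w = vecWeight u} _∷_ (λ { refl → refl , refl }) (λ { (x ∷ xs) → x , xs , refl })
      (λ _ _ → refl) (E 0) (enumerate-vec m (E ∘ suc)) (c 0) (product-counts m (E ∘ suc) (c ∘ suc))

  power-counts : ∀ m {u : X → ℕ} (E : Enumeration (λ _ → ⊤) u) {F : PowerSeries} →
    Counts E F → Counts (enumerate-vec m (λ _ → E)) (F ⊛^ m)
  power-counts zero    E c = 1#-counts {X}
  power-counts (suc m) {u} E c =
    convolution-counts {w = vecWeight (λ _ → u)} _∷_ (λ { refl → refl , refl }) (λ { (x ∷ xs) → x , xs , refl })
      (λ _ _ → refl) E (enumerate-vec m (λ _ → E)) c (power-counts m E c)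

-- The coefficient of degree `d` in `*-recip`, solved for the leading term: multiplication by 1 -
-- q^(l+1) subtracts a copy shifted by `suc l`, which `select` turns into 0 when `d` is too small.
geometric-recurrence : ∀ l d →
  recip (1# ⊝ q ⊛^ suc l) d ≡ 1# d ℤ.+ select (suc d) (suc l) (λ i → recip (1# ⊝ q ⊛^ suc l) (d ∸ i))
geometric-recurrence l d = begin
  g d                               ≡⟨ ℤ.+-identityʳ (g d) ⟨
  g d ℤ.+ 0ℤ                        ≡⟨ cong (λ z → g d ℤ.+ z) (ℤ.+-inverseˡ S) ⟨
  g d ℤ.+ (ℤ.- S ℤ.+ S)             ≡⟨ ℤ.+-assoc (g d) (ℤ.- S) S ⟨
  g d ℤ.+ ℤ.- S ℤ.+ S               ≡⟨ cong (ℤ._+ S) expand ⟨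
  (f ⊛ g) d ℤ.+ S                   ≡⟨ cong (ℤ._+ S) (*-recip f ([1-q^]₀≡1 l) d) ⟩
  1# d ℤ.+ S                        ∎
  where
  open ≡-Reasoning
  f = 1# ⊝ q ⊛^ suc l
  g = recip f
  h : ℕ → ℤ
  h i = g (d ∸ i)
  S = select (suc d) (suc l) h
  expand : (f ⊛ g) d ≡ g d ℤ.+ ℤ.- S
  expand = begin
    sumℤ {suc d} (λ i → f (toℕ i) ℤ.* h (toℕ i))
      ≡⟨ sumℤ-cong {suc d} (λ i → trans
           (cong (ℤ._* h (toℕ i)) (cong₂ (λ a b → a ℤ.+ ℤ.- b) (1#≈monomial (toℕ i)) (q^≈monomial (suc l) (toℕ i))))
           (trans (ℤ.*-distribʳ-+ (h (toℕ i)) (monomial 0 (toℕ i)) (ℤ.- monomial (suc l) (toℕ i)))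
                  (cong (λ z → monomial 0 (toℕ i) ℤ.* h (toℕ i) ℤ.+ z)
                        (sym (ℤ.neg-distribˡ-* (monomial (suc l) (toℕ i)) (h (toℕ i))))))) ⟩
    sumℤ {suc d} (λ i → monomial 0 (toℕ i) ℤ.* h (toℕ i) ℤ.+ ℤ.- (monomial (suc l) (toℕ i) ℤ.* h (toℕ i)))
      ≡⟨ sumℤ-+ {suc d} (λ i → monomial 0 i ℤ.* h i) (λ i → ℤ.- (monomial (suc l) i ℤ.* h i)) ⟩
    sumℤ {suc d} (λ i → monomial 0 (toℕ i) ℤ.* h (toℕ i)) ℤ.+ sumℤ {suc d} (λ i → ℤ.- (monomial (suc l) (toℕ i) ℤ.* h (toℕ i)))
      ≡⟨ cong₂ ℤ._+_ (sumℤ-monomial (suc d) 0 h)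
           (trans (sumℤ-neg {suc d} (λ i → monomial (suc l) i ℤ.* h i))
                  (cong (λ z → ℤ.- z) (sumℤ-monomial (suc d) (suc l) h))) ⟩
    g d ℤ.+ ℤ.- S ∎

select-≥ : ∀ n a h → n ≤ a → select n a h ≡ 0ℤ
select-≥ zero    a       h _       = refl
select-≥ (suc n) (suc a) h (s≤s p) = select-≥ n a (h ∘ suc) p

select-< : ∀ n a h → a < n → select n a h ≡ h a
select-< (suc n) zero    h _       = refl
select-< (suc n) (suc a) h (s≤s p) = select-< n a (h ∘ suc) p

multiples : (l d : ℕ) → List ℕ
multiples l d with suc l ∣? d
... | yes (divides j _) = j ∷ []
... | no  _             = []

-- Here `j` stands for a single matrix entry d(i,l+1) and `suc l * j` for its share of the corner
-- volume.
enumerate-multiples : ∀ l → Enumeration (λ _ → ⊤) (suc l *_)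
enumerate-multiples l = record
  { list     = multiples l
  ; unique   = unique′
  ; sound    = λ {d} j∈ → tt , sound′ d j∈
  ; complete = λ {j} _ → complete′ j
  }
  where
  unique′ : ∀ d → Unique (multiples l d)
  unique′ d with suc l ∣? d
  ... | yes _ = [] ∷ []
  ... | no  _ = []
  sound′ : ∀ d {j} → j ∈ multiples l d → suc l * j ≡ d
  sound′ d j∈ with suc l ∣? d
  sound′ d (here refl) | yes (divides j eq) = trans (*-comm (suc l) j) (sym eq)
  complete′ : ∀ j → j ∈ multiples l (suc l * j)
  complete′ j with suc l ∣? (suc l * j)
  ... | yes (divides i eq) = here (*-cancelˡ-≡ j i (suc l) (trans eq (*-comm i (suc l))))
  ... | no  ∤              = contradiction (divides j (*-comm (suc l) j)) ∤

length-multiples-∣ : ∀ l d → suc l ∣ d → length (multiples l d) ≡ 1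
length-multiples-∣ l d l∣d with suc l ∣? d
... | yes _ = refl
... | no  ∤ = contradiction l∣d ∤

length-multiples-∤ : ∀ l d → ¬ suc l ∣ d → length (multiples l d) ≡ 0
length-multiples-∤ l d l∤d with suc l ∣? d
... | yes ∣d = contradiction ∣d l∤d
... | no  _  = refl

length-multiples-+ : ∀ l d → length (multiples l (suc l + d)) ≡ length (multiples l d)
length-multiples-+ l d with suc l ∣? d
... | yes l∣d = length-multiples-∣ l (suc l + d) (∣m∣n⇒∣m+n (∣-refl {suc l}) l∣d)
... | no  l∤d = length-multiples-∤ l (suc l + d) (λ p → l∤d (∣m+n∣m⇒∣n p (∣-refl {suc l})))

-- Both sides obey the same recurrence: from degree `suc l` on they repeat with period `suc l`, and
-- below it only degree 0 contributes.
geometric-counts : ∀ l → Counts (enumerate-multiples l) (recip (1# ⊝ q ⊛^ suc l))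
geometric-counts l = <-rec _ go
  where
  g = recip (1# ⊝ q ⊛^ suc l)
  go : ∀ d → (∀ {e} → e < d → g e ≡ ℤ.+ length (multiples l e)) → g d ≡ ℤ.+ length (multiples l d)
  go zero      ih = trans (geometric-recurrence l 0) (cong ℤ.+_ (sym (length-multiples-∣ l 0 (divides 0 refl))))
  go d@(suc e) ih with suc l ≤? d
  ... | no l≰d = trans (geometric-recurrence l d)
    (trans (cong (λ z → 0ℤ ℤ.+ z) (select-≥ (suc d) (suc l) (λ i → g (d ∸ i)) (≰⇒> l≰d)))
           (cong ℤ.+_ (sym (length-multiples-∤ l d (λ l∣d → l≰d (∣⇒≤ l∣d))))))
  ... | yes l≤d = begin
    g d                                               ≡⟨ geometric-recurrence l d ⟩
    0ℤ ℤ.+ select (suc d) (suc l) (λ i → g (d ∸ i))   ≡⟨ ℤ.+-identityˡ _ ⟩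
    select (suc d) (suc l) (λ i → g (d ∸ i))          ≡⟨ select-< (suc d) (suc l) (λ i → g (d ∸ i)) (s≤s l≤d) ⟩
    g (d ∸ suc l)                                     ≡⟨ ih (∸-monoʳ-< z<s l≤d) ⟩
    ℤ.+ length (multiples l (d ∸ suc l))                ≡⟨ cong ℤ.+_ (length-multiples-+ l (d ∸ suc l)) ⟨
    ℤ.+ length (multiples l (suc l + (d ∸ suc l)))      ≡⟨ cong (λ e → ℤ.+ length (multiples l e)) (m+[n∸m]≡n l≤d) ⟩
    ℤ.+ length (multiples l d)                          ∎
    where open ≡-Reasoning

-- Conjugates of antitone sequences and the corner volume

Antitone : (ℕ → ℕ) → Set
Antitone f = ∀ x → f (suc x) ≤ f x

antitone-0 : ∀ {f} → Antitone f → ∀ x → f x ≤ f 0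
antitone-0 anti zero    = ≤-refl
antitone-0 anti (suc x) = ≤-trans (anti x) (antitone-0 anti x)

-- For antitone f supported on x < b: the number of x with y < f x.
conjugate : ℕ → (ℕ → ℕ) → ℕ → ℕ
conjugate zero    f y = 0
conjugate (suc b) f y with y <? f 0
... | yes _ = suc (conjugate b (f ∘ suc) y)
... | no  _ = 0

conjugate-< : ∀ {b f y} → y < f 0 → conjugate (suc b) f y ≡ suc (conjugate b (f ∘ suc) y)
conjugate-< {f = f} {y} y<f₀ with y <? f 0
... | yes _    = refl
... | no  y≮f₀ = contradiction y<f₀ y≮f₀

conjugate-≥ : ∀ b {f y} → f 0 ≤ y → conjugate b f y ≡ 0
conjugate-≥ zero    f₀≤y = refl
conjugate-≥ (suc b) {f} {y} f₀≤y with y <? f 0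
... | yes y<f₀ = contradiction y<f₀ (≤⇒≯ f₀≤y)
... | no  _    = refl

<-conjugate⇒ : ∀ b f {x y} → x < conjugate b f y → y < f x
<-conjugate⇒ (suc b) f {x} {y} x< with y <? f 0
<-conjugate⇒ (suc b) f {zero}  x<       | yes y<f₀ = y<f₀
<-conjugate⇒ (suc b) f {suc x} (s≤s x<) | yes _    = <-conjugate⇒ b (f ∘ suc) x<

-- Together with `<-conjugate⇒` this is the symmetric equivalence between `x < conjugate b f y` and
-- `y < f x`, which makes conjugation an involution.
<-conjugate : ∀ b {f x y} → Antitone f → (∀ x → b ≤ x → f x ≡ 0) → y < f x → x < conjugate b f y
<-conjugate zero    {x = x} anti supp y<fx = contradiction (subst (_ <_) (supp x z≤n) y<fx) n≮0
<-conjugate (suc b) {f} {x} {y} anti supp y<fx with y <? f 0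
... | no  y≮f₀ = contradiction (<-≤-trans y<fx (antitone-0 anti x)) y≮f₀
<-conjugate (suc b) {x = zero}  anti supp y<fx | yes _ = z<s
<-conjugate (suc b) {x = suc x} anti supp y<fx | yes _ =
  s≤s (<-conjugate b (anti ∘ suc) (λ x → supp (suc x) ∘ s≤s) y<fx)

conjugate-≤ : ∀ b f y → conjugate b f y ≤ b
conjugate-≤ zero    f y = z≤n
conjugate-≤ (suc b) f y with y <? f 0
... | yes _ = s≤s (conjugate-≤ b (f ∘ suc) y)
... | no  _ = z≤n

<-ext : ∀ {a b} → (∀ {x} → x < a → x < b) → (∀ {x} → x < b → x < a) → a ≡ b
<-ext {zero}  {zero}  _ _ = refl
<-ext {zero}  {suc b} _ g = contradiction (g (n<1+n b)) n≮0
<-ext {suc a} {zero}  f _ = contradiction (f (n<1+n a)) n≮0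
<-ext {suc a} {suc b} f g = ≤-antisym (f (n<1+n a)) (g (n<1+n b))

conjugate-mono : ∀ b {f g} → (∀ x → f x ≤ g x) → ∀ y → conjugate b f y ≤ conjugate b g y
conjugate-mono zero    f≤g y = z≤n
conjugate-mono (suc b) {f} {g} f≤g y with y <? f 0 | y <? g 0
... | yes _  | yes _  = s≤s (conjugate-mono b (f≤g ∘ suc) y)
... | yes p  | no ¬p  = contradiction (<-≤-trans p (f≤g 0)) ¬p
... | no  _  | _      = z≤n

conjugate-antitone : ∀ b f → Antitone (conjugate b f)
conjugate-antitone zero    f y = z≤n
conjugate-antitone (suc b) f y with suc y <? f 0 | y <? f 0
... | yes _ | yes _ = s≤s (conjugate-antitone b (f ∘ suc) y)
... | yes p | no ¬p = contradiction (m<1+n⇒m≤n (m<n⇒m<1+n p)) ¬p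
... | no  _ | _     = z≤n

conjugate-cong : ∀ b {f g} → (∀ x → f x ≡ g x) → ∀ y → conjugate b f y ≡ conjugate b g y
conjugate-cong b f≗g y =
  ≤-antisym (conjugate-mono b (≤-reflexive ∘ f≗g) y) (conjugate-mono b (≤-reflexive ∘ sym ∘ f≗g) y)

conjugate-conjugate : ∀ b c {f} → Antitone f → (∀ x → b ≤ x → f x ≡ 0) →
  (∀ y → c ≤ y → conjugate b f y ≡ 0) → ∀ x → conjugate c (conjugate b f) x ≡ f x
conjugate-conjugate b c {f} anti supp supp′ x = <-ext
  (<-conjugate⇒ b f ∘ <-conjugate⇒ c (conjugate b f))
  (<-conjugate c (conjugate-antitone b f) supp′ ∘ <-conjugate b anti supp)

-- Finite sums and the corner volume

∑ : ℕ → (ℕ → ℕ) → ℕ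
∑ zero    f = 0
∑ (suc n) f = f 0 + ∑ n (f ∘ suc)

∑-cong : ∀ n {f g} → (∀ i → f i ≡ g i) → ∑ n f ≡ ∑ n g
∑-cong zero    f≗g = refl
∑-cong (suc n) f≗g = cong₂ _+_ (f≗g 0) (∑-cong n (f≗g ∘ suc))

∑-zero : ∀ n {f} → (∀ i → f i ≡ 0) → ∑ n f ≡ 0
∑-zero zero    f≗0 = refl
∑-zero (suc n) f≗0 = cong₂ _+_ (f≗0 0) (∑-zero n (f≗0 ∘ suc))

∑-+ : ∀ n f g → ∑ n (λ i → f i + g i) ≡ ∑ n f + ∑ n g
∑-+ zero    f g = refl
∑-+ (suc n) f g = trans (cong (f 0 + g 0 +_) (∑-+ n (f ∘ suc) (g ∘ suc)))
                        (interchange (f 0) (g 0) _ _)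
  where
  interchange : ∀ a b c d → (a + b) + (c + d) ≡ (a + c) + (b + d)
  interchange = solve-∀

∑-* : ∀ n c f → ∑ n (λ i → c * f i) ≡ c * ∑ n f
∑-* zero    c f = sym (*-zeroʳ c)
∑-* (suc n) c f = trans (cong (c * f 0 +_) (∑-* n c (f ∘ suc))) (sym (*-distribˡ-+ c (f 0) _))

∑-swap : ∀ n m (f : ℕ → ℕ → ℕ) → ∑ n (λ i → ∑ m (f i)) ≡ ∑ m (λ j → ∑ n (λ i → f i j))
∑-swap zero    m f = sym (∑-zero m (λ _ → refl))
∑-swap (suc n) m f = trans (cong (∑ m (f 0) +_) (∑-swap n m (f ∘ suc)))
                           (sym (∑-+ m (f 0) (λ j → ∑ n (λ i → f (suc i) j))))

∑-last : ∀ n f → ∑ (suc n) f ≡ f n + ∑ n f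
∑-last zero    f = refl
∑-last (suc n) f = trans (cong (f 0 +_) (∑-last n (f ∘ suc))) (left-comm (f 0) (f (suc n)) _)
  where
  left-comm : ∀ a b c → a + (b + c) ≡ b + (a + c)
  left-comm = solve-∀

-- Needed to exchange the side of the square in `cornerVolume`, an arbitrary bound of the support,
-- for the number of rows.
∑-support : ∀ b n {f} → (∀ i → b ≤ i → f i ≡ 0) → (∀ i → n ≤ i → f i ≡ 0) → ∑ b f ≡ ∑ n f
∑-support zero    n       p _ = sym (∑-zero n (λ i → p i z≤n))
∑-support (suc b) zero    _ p = ∑-zero (suc b) (λ i → p i z≤n)
∑-support (suc b) (suc n) p p′ =
  cong (_ +_) (∑-support b n (λ i → p (suc i) ∘ s≤s) (λ i → p′ (suc i) ∘ s≤s))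

module _ {P : ℕ × ℕ → Set} (P? : Decidable P) (f : ℕ × ℕ → ℕ) where

  restrict : ℕ × ℕ → ℕ
  restrict x with P? x
  ... | yes _ = f x
  ... | no  _ = 0

  sum-filter : ∀ xs → ℕ.sum (List.map f (filter P? xs)) ≡ ℕ.sum (List.map restrict xs)
  sum-filter []       = refl
  sum-filter (x ∷ xs) with P? x
  ... | yes _ = cong (f x +_) (sum-filter xs)
  ... | no  _ = sum-filter xs

sum-applyUpTo : ∀ (f h : ℕ → ℕ) n → ℕ.sum (List.map f (applyUpTo h n)) ≡ ∑ n (f ∘ h)
sum-applyUpTo f h zero    = refl
sum-applyUpTo f h (suc n) = cong (f (h 0) +_) (sum-applyUpTo f (h ∘ suc) n)

sum-cartesianProduct : ∀ (f : ℕ × ℕ → ℕ) b (h : ℕ → ℕ) n →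
  ℕ.sum (List.map f (cartesianProduct (applyUpTo h n) (upTo b))) ≡ ∑ n (λ i → ∑ b (λ j → f (h i , j)))
sum-cartesianProduct f b h zero    = refl
sum-cartesianProduct f b h (suc n) = begin
  ℕ.sum (List.map f (List.map (h 0 ,_) (upTo b) List.++ rest))
    ≡⟨ cong ℕ.sum (map-++ f (List.map (h 0 ,_) (upTo b)) rest) ⟩
  ℕ.sum (List.map f (List.map (h 0 ,_) (upTo b)) List.++ List.map f rest)
    ≡⟨ ℕ.sum-++ (List.map f (List.map (h 0 ,_) (upTo b))) _ ⟩
  ℕ.sum (List.map f (List.map (h 0 ,_) (upTo b))) + ℕ.sum (List.map f rest)
    ≡⟨ cong₂ _+_ (trans (cong ℕ.sum (sym (List.map-∘ (upTo b)))) (sum-applyUpTo (λ j → f (h 0 , j)) id b))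
                 (sum-cartesianProduct f b (h ∘ suc) n) ⟩
  ∑ b (λ j → f (h 0 , j)) + ∑ n (λ i → ∑ b (λ j → f (h (suc i) , j))) ∎
  where
  open ≡-Reasoning
  rest = cartesianProduct (applyUpTo (h ∘ suc) n) (upTo b)

-- The contribution of one cell to the corner volume, with entry `a` and entry `b` below it.
fall : ℕ → ℕ → ℕ
fall a b with b <? a
... | yes _ = a
... | no  _ = 0

cornerVolume-∑ : ∀ π → cornerVolume π ≡
  ∑ (bound π) (λ i → ∑ (bound π) (λ j → fall (entry π i j) (entry π (suc i) j)))
cornerVolume-∑ π = trans (sum-filter (Des? π) (uncurry (entry π)) (cartesianProduct (upTo (bound π)) (upTo (bound π))))
  (trans (sum-cartesianProduct (restrict (Des? π) (uncurry (entry π))) (bound π) id (bound π))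
         (∑-cong (bound π) (λ i → ∑-cong (bound π) (λ j → restrict≡ i j))))
  where
  restrict≡ : ∀ i j → restrict (Des? π) (uncurry (entry π)) (i , j) ≡ fall (entry π i j) (entry π (suc i) j)
  restrict≡ i j with entry π (suc i) j <? entry π i j
  ... | yes _ = refl
  ... | no  _ = refl

δ : ℕ → ℕ → ℕ
δ zero    zero    = 1
δ zero    (suc l) = 0
δ (suc a) zero    = 0
δ (suc a) (suc l) = δ a l

δ-diagonal : ∀ a → δ a a ≡ 1
δ-diagonal zero    = refl
δ-diagonal (suc a) = δ-diagonal a

δ-off : ∀ {a l} → a ≢ l → δ a l ≡ 0
δ-off {zero}  {zero}  a≢l = contradiction refl a≢l
δ-off {zero}  {suc l} a≢l = refl
δ-off {suc a} {zero}  a≢l = refl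
δ-off {suc a} {suc l} a≢l = δ-off (a≢l ∘ cong suc)

∑-δ : ∀ m a (f : ℕ → ℕ) → a < m → ∑ m (λ l → f l * δ a l) ≡ f a
∑-δ (suc m) zero    f _         = trans
  (cong₂ _+_ (*-identityʳ (f 0)) (∑-zero m (λ l → *-zeroʳ (f (suc l)))))
  (+-identityʳ (f 0))
∑-δ (suc m) (suc a) f (s≤s a<m) = trans (cong (_+ ∑ m (λ l → f (suc l) * δ a l)) (*-zeroʳ (f 0))) (∑-δ m a (f ∘ suc) a<m)

-- The share of a single column in `jump`: it is 1 when `y < x` and `x ≡ suc l`, and 0 otherwise.
mark : ℕ → ℕ → ℕ → ℕ
mark zero    y l = 0
mark (suc x) y l with y <? suc x
... | yes _ = δ x l
... | no  _ = 0

mark-off : ∀ {x} y {l} → x ≢ suc l → mark x y l ≡ 0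
mark-off {zero}  y x≢ = refl
mark-off {suc x} y x≢ with y <? suc x
... | yes _ = δ-off (x≢ ∘ cong suc)
... | no  _ = refl

∑-mark : ∀ m x y → x ≤ m → ∑ m (λ l → suc l * mark x y l) ≡ fall x y
∑-mark m zero    y _   = ∑-zero m (λ l → *-zeroʳ l)
∑-mark m (suc x) y x<m with y <? suc x
... | yes _ = ∑-δ m x suc x<m
... | no  _ = ∑-zero m (λ l → *-zeroʳ l)

-- The number of c with g c < f c = suc l, for g ≤ f.
jump : ℕ → (f g : ℕ → ℕ) → ℕ → ℕ
jump b f g l = conjugate b f l ∸ (conjugate b f (suc l) ⊔ conjugate b g l)

-- Column 0 is split off. If `suc l < f 0`, it raises both conjugate values of `f` by one and their
-- difference stays. If `f 0 < suc l`, there is nothing to count. In case of equality the value at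
-- `suc l` vanishes, and column 0 counts unless it also enters the conjugate of `g`.
jump-suc : ∀ b {f g} → Antitone f → Antitone g → (∀ x → g x ≤ f x) → ∀ l →
  jump (suc b) f g l ≡ mark (f 0) (g 0) l + jump b (f ∘ suc) (g ∘ suc) l
jump-suc b {f} {g} af ag g≤f l with <-cmp (suc l) (f 0)
... | tri< sl<f₀ sl≢f₀ _
  rewrite mark-off (g 0) (sl≢f₀ ∘ sym) | conjugate-< {b} {f} (<-trans (n<1+n l) sl<f₀) | conjugate-< {b} {f} sl<f₀
  with l <? g 0
... | yes l<g₀ = refl
... | no  l≮g₀ rewrite conjugate-≥ b {g ∘ suc} (≤-trans (ag 0) (≮⇒≥ l≮g₀)) =
  cong (conjugate b (f ∘ suc) l ∸_) (sym (⊔-identityʳ (conjugate b (f ∘ suc) (suc l))))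
jump-suc b {f} {g} af ag g≤f l | tri> _ sl≢f₀ f₀<sl
  rewrite mark-off (g 0) (sl≢f₀ ∘ sym) | conjugate-≥ (suc b) {f} (s≤s⁻¹ f₀<sl)
        | conjugate-≥ b {f ∘ suc} (≤-trans (af 0) (s≤s⁻¹ f₀<sl)) =
  trans (0∸n≡0 (conjugate (suc b) f (suc l) ⊔ _)) (sym (0∸n≡0 (conjugate b (f ∘ suc) (suc l) ⊔ _)))
jump-suc b {f} {g} af ag g≤f l | tri≈ _ sl≡f₀ _
  rewrite conjugate-< {b} {f} (≤-reflexive sl≡f₀) | conjugate-≥ (suc b) {f} (≤-reflexive (sym sl≡f₀))
        | conjugate-≥ b {f ∘ suc} (≤-trans (af 0) (≤-reflexive (sym sl≡f₀))) | sym sl≡f₀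
  with g 0 <? suc l | l <? g 0
... | yes _    | no  l≮g₀ rewrite δ-diagonal l | conjugate-≥ b {g ∘ suc} (≤-trans (ag 0) (≮⇒≥ l≮g₀)) = refl
... | no  _    | yes _    = refl
... | yes g₀≤l | yes l<g₀ = contradiction l<g₀ (≤⇒≯ (s≤s⁻¹ g₀≤l))
... | no  g₀≰l | no  l≮g₀ = contradiction (s≤s (≮⇒≥ l≮g₀)) g₀≰l

-- For a row `f` with the row `g` below it, the cells that contribute are grouped by their entry.
∑-fall : ∀ b m {f g} → Antitone f → Antitone g → (∀ x → g x ≤ f x) → (∀ x → f x ≤ m) →
  ∑ b (λ x → fall (f x) (g x)) ≡ ∑ m (λ l → suc l * jump b f g l)
∑-fall zero    m         _  _  _   _   = sym (∑-zero m (λ l → *-zeroʳ l))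
∑-fall (suc b) m {f} {g} af ag g≤f f≤m = begin
  fall (f 0) (g 0) + ∑ b (λ x → fall (f (suc x)) (g (suc x)))
    ≡⟨ cong₂ _+_ (sym (∑-mark m (f 0) (g 0) (f≤m 0)))
                 (∑-fall b m (af ∘ suc) (ag ∘ suc) (g≤f ∘ suc) (f≤m ∘ suc)) ⟩
  ∑ m (λ l → suc l * mark (f 0) (g 0) l) + ∑ m (λ l → suc l * jump b (f ∘ suc) (g ∘ suc) l)
    ≡⟨ ∑-+ m _ _ ⟨
  ∑ m (λ l → suc l * mark (f 0) (g 0) l + suc l * jump b (f ∘ suc) (g ∘ suc) l)
    ≡⟨ ∑-cong m (λ l → trans (sym (*-distribˡ-+ (suc l) (mark (f 0) (g 0) l) _))
                             (cong (suc l *_) (sym (jump-suc b af ag g≤f l)))) ⟩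
  ∑ m (λ l → suc l * jump (suc b) f g l) ∎
  where open ≡-Reasoning

-- Plane partitions by the columns of their levels

tab : ∀ n → (ℕ → ℕ) → Vec ℕ n
tab zero    f = []
tab (suc n) f = f 0 ∷ tab n (f ∘ suc)

tab-cong : ∀ n {f g} → (∀ i → f i ≡ g i) → tab n f ≡ tab n g
tab-cong zero    f≗g = refl
tab-cong (suc n) f≗g = cong₂ _∷_ (f≗g 0) (tab-cong n (f≗g ∘ suc))

tab-constant : ∀ n {f} c → (∀ i → i < n → f i ≡ c) → tab n f ≡ Vec.replicate n c
tab-constant zero    c f≗c = refl
tab-constant (suc n) c f≗c = cong₂ _∷_ (f≗c 0 z<s) (tab-constant n c (λ i → f≗c (suc i) ∘ s≤s))

at : ∀ {n} → Vec ℕ n → ℕ → ℕ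
at []      i       = 0
at (x ∷ v) zero    = x
at (x ∷ v) (suc i) = at v i

at-tab : ∀ n f → (∀ i → n ≤ i → f i ≡ 0) → ∀ i → at (tab n f) i ≡ f i
at-tab zero    f supp i       = sym (supp i z≤n)
at-tab (suc n) f supp zero    = refl
at-tab (suc n) f supp (suc i) = at-tab n (f ∘ suc) (λ i → supp (suc i) ∘ s≤s) i

tab-at : ∀ {n} (v : Vec ℕ n) → tab n (at v) ≡ v
tab-at []      = refl
tab-at (x ∷ v) = cong (x ∷_) (tab-at v)

at-≥ : ∀ {n} (v : Vec ℕ n) i → n ≤ i → at v i ≡ 0
at-≥ []      i       _         = refl
at-≥ (x ∷ v) (suc i) (s≤s n≤i) = at-≥ v i n≤i

-- The column of index m ∸ 1 comes first.
columns : ∀ m n → (ℕ → ℕ → ℕ) → Vec (Vec ℕ n) m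
columns zero    n r = []
columns (suc m) n r = tab n (λ i → r i m) ∷ columns m n r

colAt : ∀ {m n} → Vec (Vec ℕ n) m → ℕ → ℕ → ℕ
colAt []              i l = 0
colAt {suc m} (v ∷ R) i l with l ≟ m
... | yes _ = at v i
... | no  _ = colAt R i l

colAt-head : ∀ {m n} (v : Vec ℕ n) (R : Vec _ m) i → colAt (v ∷ R) i m ≡ at v i
colAt-head {m} v R i with m ≟ m
... | yes _  = refl
... | no  m≢ = contradiction refl m≢

colAt-tail : ∀ {m n} (v : Vec ℕ n) (R : Vec _ m) i {l} → l ≢ m → colAt (v ∷ R) i l ≡ colAt R i l
colAt-tail {m} v R i {l} l≢m with l ≟ m
... | yes l≡m = contradiction l≡m l≢m
... | no  _   = refl

colAt-≥ : ∀ {m n} (R : Vec (Vec ℕ n) m) i l → m ≤ l → colAt R i l ≡ 0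
colAt-≥ []      i l _   = refl
colAt-≥ (v ∷ R) i l m<l = trans (colAt-tail v R i (>⇒≢ m<l)) (colAt-≥ R i l (<⇒≤ m<l))

colAt-row-≥ : ∀ {m n} (R : Vec (Vec ℕ n) m) i l → n ≤ i → colAt R i l ≡ 0
colAt-row-≥ []              i l n≤i = refl
colAt-row-≥ {suc m} (v ∷ R) i l n≤i with l ≟ m
... | yes _ = at-≥ v i n≤i
... | no  _ = colAt-row-≥ R i l n≤i

colAt-columns : ∀ m n r → (∀ i l → n ≤ i → r i l ≡ 0) → (∀ i l → m ≤ l → r i l ≡ 0) →
  ∀ i l → colAt (columns m n r) i l ≡ r i l
colAt-columns m n r rows cols i l with l <? m
... | no  l≮m = trans (colAt-≥ (columns m n r) i l (≮⇒≥ l≮m)) (sym (cols i l (≮⇒≥ l≮m)))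
... | yes l<m = go m l<m
  where
  go : ∀ m → l < m → colAt (columns m n r) i l ≡ r i l
  go (suc m) l<sm with l ≟ m
  ... | yes refl = at-tab n (λ i → r i l) (λ i → rows i l) i
  ... | no  l≢m  = go m (≤∧≢⇒< (s≤s⁻¹ l<sm) l≢m)

columns-cong : ∀ m n {r r′} → (∀ i l → l < m → r i l ≡ r′ i l) → columns m n r ≡ columns m n r′
columns-cong zero    n eq = refl
columns-cong (suc m) n eq = cong₂ _∷_ (tab-cong n (λ i → eq i m ≤-refl))
                                      (columns-cong m n (λ i l l<m → eq i l (m<n⇒m<1+n l<m)))

columns-colAt : ∀ {m n} (R : Vec (Vec ℕ n) m) → columns m n (colAt R) ≡ R
columns-colAt []      = refl
columns-colAt (v ∷ R) = cong₂ _∷_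
  (trans (tab-cong _ (colAt-head v R)) (tab-at v))
  (trans (columns-cong _ _ (λ i l l<m → colAt-tail v R i (<⇒≢ l<m))) (columns-colAt R))

head₀ : ∀ {n} → Vec ℕ n → ℕ
head₀ v = at v 0

-- From the column of one level to that of the next lower level: the first inequality compares
-- levels within a row, the second compares a row with the row below, where a missing row counts as
-- 0.
Step : ∀ {n} → Vec ℕ n → Vec ℕ n → Set
Step []      []        = ⊤
Step (x ∷ v) (x′ ∷ v′) = x ≤ x′ × head₀ v′ ≤ x′ × Step v v′

Chain : ∀ {n m} → Vec ℕ n → Vec (Vec ℕ n) m → Set
Chain v []      = ⊤
Chain v (w ∷ R) = Step v w × Chain w R

-- The column d(·,l), for the columns r(·,l+1) and r(·,l).
gain : ∀ {n} → Vec ℕ n → Vec ℕ n → Vec ℕ n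
gain []      []        = []
gain (x ∷ v) (x′ ∷ v′) = (x′ ∸ (x ⊔ head₀ v′)) ∷ gain v v′

gains : ∀ {n m} → Vec ℕ n → Vec (Vec ℕ n) m → Vec (Vec ℕ n) m
gains v []      = []
gains v (w ∷ R) = gain v w ∷ gains w R

columnWeight : ∀ {n m} → Vec (Vec ℕ n) m → ℕ
columnWeight                 []      = 0
-- The head has index `m` but counts entries equal to `suc m`.
columnWeight {m = suc m} (d ∷ D) = suc m * sum d + columnWeight D

step-≤ : ∀ {n} {v w : Vec ℕ n} → Step v w → ∀ i → at v i ≤ at w i
step-≤ {v = []}    {[]}    _           i       = z≤n
step-≤ {v = _ ∷ _} {_ ∷ _} (p , _ , _) zero    = p
step-≤ {v = _ ∷ _} {_ ∷ _} (_ , _ , s) (suc i) = step-≤ s i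

step-antitone : ∀ {n} {v w : Vec ℕ n} → Step v w → Antitone (at w)
step-antitone {v = []}    {[]}    _           i       = z≤n
step-antitone {v = _ ∷ _} {_ ∷ _} (_ , q , _) zero    = q
step-antitone {v = _ ∷ _} {_ ∷ _} (_ , _ , s) (suc i) = step-antitone s i

colAt-antitone-row : ∀ {n m v} (R : Vec (Vec ℕ n) m) → Chain v R → ∀ i l → colAt R (suc i) l ≤ colAt R i l
colAt-antitone-row []              _       i l = z≤n
colAt-antitone-row {m = suc m} (w ∷ R) (s , c) i l with l ≟ m
... | yes _ = step-antitone s i
... | no  _ = colAt-antitone-row R c i l

colAt-antitone : ∀ {n m v} (R : Vec (Vec ℕ n) m) → Chain v R → ∀ i → Antitone (colAt R i)
colAt-antitone []              _       i l = z≤n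
colAt-antitone {m = suc m} (w ∷ R) (s , c) i l with suc l ≟ m | l ≟ m
... | yes refl | yes ()
... | yes refl | no _     = first R c
  where
  first : ∀ {l} (R : Vec _ (suc l)) → Chain w R → at w i ≤ colAt R i l
  first (u ∷ R) (s , _) = subst (at w i ≤_) (sym (colAt-head u R i)) (step-≤ s i)
... | no _     | yes refl = subst (_≤ at w i) (sym (colAt-≥ R i (suc l) (n≤1+n l))) z≤n
... | no _     | no _     = colAt-antitone R c i l

step-tab : ∀ n {f g} → (∀ i → f i ≤ g i) → Antitone g → Step (tab n f) (tab n g)
step-tab zero    f≤g ag = tt
step-tab (suc n) {f} {g} f≤g ag = f≤g 0 , head≤ n , step-tab n (f≤g ∘ suc) (ag ∘ suc)
  where
  head≤ : ∀ n → head₀ (tab n (g ∘ suc)) ≤ g 0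
  head≤ zero    = z≤n
  head≤ (suc n) = ag 0

chain-columns : ∀ m n r → (∀ i → Antitone (r i)) → (∀ l → Antitone (λ i → r i l)) →
  Chain (tab n (λ i → r i m)) (columns m n r)
chain-columns zero    n r ar ac = tt
chain-columns (suc m) n r ar ac = step-tab n (λ i → ar i m) (ac m) , chain-columns m n r ar ac

sum-gain-tab : ∀ n {f g} → (∀ i → n ≤ i → g i ≡ 0) →
  sum (gain (tab n f) (tab n g)) ≡ ∑ n (λ i → g i ∸ (f i ⊔ g (suc i)))
sum-gain-tab zero    supp = refl
sum-gain-tab (suc n) {f} {g} supp = cong₂ _+_
  (cong (λ h → g 0 ∸ (f 0 ⊔ h)) (at-tab n (g ∘ suc) (λ i → supp (suc i) ∘ s≤s) 0))
  (sum-gain-tab n (λ i → supp (suc i) ∘ s≤s))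

columnWeight-gains : ∀ m n r → (∀ i l → n ≤ i → r i l ≡ 0) →
  columnWeight (gains (tab n (λ i → r i m)) (columns m n r)) ≡
  ∑ m (λ l → suc l * ∑ n (λ i → r i l ∸ (r i (suc l) ⊔ r (suc i) l)))
columnWeight-gains zero    n r supp = refl
columnWeight-gains (suc m) n r supp = trans
  (cong₂ _+_ (cong (suc m *_) (sum-gain-tab n (λ i → supp i m))) (columnWeight-gains m n r supp))
  (sym (∑-last m _))

-- The number of entries > l in row i.
level : PlanePartition → ℕ → ℕ → ℕ
level π i = conjugate (bound π) (entry π i)

module _ (π : PlanePartition) where

  <-level⇒ : ∀ {i c l} → c < level π i l → l < entry π i c
  <-level⇒ {i} = <-conjugate⇒ (bound π) (entry π i)

  row-support : ∀ i c → bound π ≤ c → entry π i c ≡ 0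
  row-support i c b≤c = proj₂ (finite π) i c (inj₂ b≤c)

  <-level : ∀ {i c l} → l < entry π i c → c < level π i l
  <-level {i} = <-conjugate (bound π) (row-decr π i) (row-support i)

level-cong : ∀ π σ → π ≗ₚ σ → ∀ i l → level π i l ≡ level σ i l
level-cong π σ π≗σ i l = <-ext
  (λ {c} → <-level σ ∘ subst (l <_) (π≗σ i c) ∘ <-level⇒ π)
  (λ {c} → <-level π ∘ subst (l <_) (sym (π≗σ i c)) ∘ <-level⇒ σ)

module _ {n m : ℕ} where

  encode : PlanePartition → Vec (Vec ℕ n) m
  encode π = columns m n (level π)

  encode-cong : ∀ π σ → π ≗ₚ σ → encode π ≡ encode σ
  encode-cong π σ π≗σ = columns-cong m n (λ i l _ → level-cong π σ π≗σ i l)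

  module _ {π : PlanePartition} (π∈ : PP∞ n m π) where

    level-row-≥ : ∀ i l → n ≤ i → level π i l ≡ 0
    level-row-≥ i l n≤i = conjugate-≥ (bound π) (subst (_≤ l) (sym (proj₁ π∈ i 0 n≤i)) z≤n)

    level-≥ : ∀ i l → m ≤ l → level π i l ≡ 0
    level-≥ i l m≤l = conjugate-≥ (bound π) (≤-trans (proj₂ π∈ i 0) m≤l)

    colAt-encode : ∀ i l → colAt (encode π) i l ≡ level π i l
    colAt-encode = colAt-columns m n (level π) level-row-≥ level-≥

    -- No entry exceeds `m`. The column of index `m` is therefore not encoded and serves as the
    -- fixed start of the chain.
    first-column : tab n (λ i → level π i m) ≡ Vec.replicate n 0
    first-column = tab-constant n 0 (λ i _ → level-≥ i m ≤-refl)

    encode-chain : Chain (Vec.replicate n 0) (encode π)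
    encode-chain = subst (λ v → Chain v (encode π)) first-column
      (chain-columns m n (level π) (λ i → conjugate-antitone (bound π) (entry π i))
        (λ l i → conjugate-mono (bound π) (column-decr π i) l))

    -- The gains are the jumps between adjacent rows. After exchanging the sums over levels and
    -- rows, `∑-fall` applies to one row at a time.
    encode-weight : columnWeight (gains (Vec.replicate n 0) (encode π)) ≡ cornerVolume π
    encode-weight = begin
      columnWeight (gains (Vec.replicate n 0) (encode π))
        ≡⟨ cong (λ v → columnWeight (gains v (encode π))) first-column ⟨
      columnWeight (gains (tab n (λ i → level π i m)) (encode π))
        ≡⟨ columnWeight-gains m n (level π) level-row-≥ ⟩
      ∑ m (λ l → suc l * ∑ n (λ i → jump (bound π) (entry π i) (entry π (suc i)) l))
        ≡⟨ ∑-cong m (λ l → ∑-* n (suc l) _) ⟨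
      ∑ m (λ l → ∑ n (λ i → suc l * jump (bound π) (entry π i) (entry π (suc i)) l))
        ≡⟨ ∑-swap m n _ ⟩
      ∑ n (λ i → ∑ m (λ l → suc l * jump (bound π) (entry π i) (entry π (suc i)) l))
        ≡⟨ ∑-cong n (λ i → ∑-fall (bound π) m (row-decr π i) (row-decr π (suc i)) (column-decr π i) (proj₂ π∈ i)) ⟨
      ∑ n (λ i → ∑ (bound π) (λ j → fall (entry π i j) (entry π (suc i) j)))
        ≡⟨ ∑-support (bound π) n (λ i b≤i → zero-row i (λ j → proj₂ (finite π) i j (inj₁ b≤i)))
                                 (λ i n≤i → zero-row i (λ j → proj₁ π∈ i j n≤i)) ⟨
      ∑ (bound π) (λ i → ∑ (bound π) (λ j → fall (entry π i j) (entry π (suc i) j)))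
        ≡⟨ cornerVolume-∑ π ⟨
      cornerVolume π ∎
      where
      open ≡-Reasoning
      zero-row : ∀ i → (∀ j → entry π i j ≡ 0) → ∑ (bound π) (λ j → fall (entry π i j) (entry π (suc i) j)) ≡ 0
      zero-row i π≡0 = ∑-zero (bound π) (λ j → cong (λ a → fall a (entry π (suc i) j)) (π≡0 j))

  module _ (R : Vec (Vec ℕ n) m) (c : Chain (Vec.replicate n 0) R) where

    private
      r = colAt R

      r≤r₀₀ : ∀ i l → r i l ≤ r 0 0
      r≤r₀₀ i l = ≤-trans (antitone-0 (colAt-antitone R c i) l)
                          (antitone-0 {λ i → r i 0} (λ i → colAt-antitone-row R c i 0) i)

    decode-column-≥ : ∀ i j → r 0 0 ≤ j → conjugate m (r i) j ≡ 0
    decode-column-≥ i j r≤j = conjugate-≥ m (≤-trans (r≤r₀₀ i 0) r≤j)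

    decode-row-≥ : ∀ i j → n ≤ i → conjugate m (r i) j ≡ 0
    decode-row-≥ i j n≤i = conjugate-≥ m (subst (_≤ j) (sym (colAt-row-≥ R i 0 n≤i)) z≤n)

    decode : PlanePartition
    decode = record
      { entry       = λ i j → conjugate m (r i) j
      ; column-decr = λ i j → conjugate-mono m (colAt-antitone-row R c i) j
      ; row-decr    = λ i j → conjugate-antitone m (r i) j
      -- One bound has to serve both directions: rows vanish from `n` on and columns from `r 0 0`
      -- on, the largest value of `r`.
      ; finite      = n + r 0 0 , λ
        { i j (inj₁ b≤i) → decode-row-≥ i j (≤-trans (m≤m+n n (r 0 0)) b≤i)
        ; i j (inj₂ b≤j) → decode-column-≥ i j (≤-trans (m≤n+m (r 0 0) n) b≤j)
        }
      }

    decode-∈ : PP∞ n m decode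
    decode-∈ = decode-row-≥ , (λ i j → conjugate-≤ m (r i) j)

    level-decode : ∀ i l → level decode i l ≡ r i l
    level-decode i l = conjugate-conjugate m (bound decode) (colAt-antitone R c i) (colAt-≥ R i)
      (λ j b≤j → decode-column-≥ i j (≤-trans (m≤n+m (r 0 0) n) b≤j)) l

    encode-decode : encode decode ≡ R
    encode-decode = trans (columns-cong m n (λ i l _ → level-decode i l)) (columns-colAt R)

  decode-encode : ∀ π → PP∞ n m π → (c : Chain (Vec.replicate n 0) (encode π)) → decode (encode π) c ≗ₚ π
  decode-encode π π∈ c i j = trans
    (conjugate-cong m (colAt-encode {π} π∈ i) j)
    (conjugate-conjugate (bound π) m (row-decr π i) (row-support π i) (level-≥ {π} π∈ i) j)

-- A bound k on the levels is the nonnegativity of the k ∸ level.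
complement : ∀ {n} → ℕ → Vec ℕ n → Vec ℕ n
complement k = Vec.map (k ∸_)

Bounded : ∀ {n} → ℕ → Vec ℕ n → Set
Bounded k = VecAll.All (_≤ k)

complement-bounded : ∀ {n} k (v : Vec ℕ n) → Bounded k (complement k v)
complement-bounded k []      = []
complement-bounded k (x ∷ v) = m∸n≤m k x ∷ complement-bounded k v

complement-involutive : ∀ {n k} {v : Vec ℕ n} → Bounded k v → complement k (complement k v) ≡ v
complement-involutive []        = refl
complement-involutive (x≤k ∷ b) = cong₂ _∷_ (m∸[m∸n]≡n x≤k) (complement-involutive b)

complements-involutive : ∀ {n m k} {R : Vec (Vec ℕ n) m} → VecAll.All (Bounded k) R →
  Vec.map (complement k) (Vec.map (complement k) R) ≡ R
complements-involutive []      = refl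
complements-involutive (b ∷ bs) = cong₂ _∷_ (complement-involutive b) (complements-involutive bs)

step-complement : ∀ {n} k (v w : Vec ℕ n) → Step v w → EdgeStep (complement k v) (complement k w)
step-complement k []      []        _           = tt
step-complement k (x ∷ v) (x′ ∷ w) (p , q , s) = ∸-monoʳ-≤ k p , below w q , step-complement k v w s
  where
  below : ∀ {n} (w : Vec ℕ n) → head₀ w ≤ x′ → k ∸ x′ ≤ʰ complement k w
  below []      _ = tt
  below (y ∷ _) q = ∸-monoʳ-≤ k q

complement-step : ∀ {n} k (v w : Vec ℕ n) → EdgeStep v w → Step (complement k v) (complement k w)
complement-step k []      []       _           = tt
complement-step k (x ∷ v) (x′ ∷ w) (p , q , s) = ∸-monoʳ-≤ k p , above w q , complement-step k v w s
  where
  above : ∀ {n} (w : Vec ℕ n) → x′ ≤ʰ w → head₀ (complement k w) ≤ k ∸ x′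
  above []      _ = z≤n
  above (y ∷ _) q = ∸-monoʳ-≤ k q

edgeStep-bounded : ∀ {n k} {v w : Vec ℕ n} → Bounded k v → EdgeStep v w → Bounded k w
edgeStep-bounded {v = []}    {[]}    []        _           = []
edgeStep-bounded {v = _ ∷ _} {_ ∷ _} (x≤k ∷ b) (p , _ , s) = ≤-trans p x≤k ∷ edgeStep-bounded b s

∸-∸ : ∀ {k x} y → x ≤ k → k ∸ y ∸ (k ∸ x) ≡ x ∸ y
∸-∸ {k} {x} y x≤k = begin
  k ∸ y ∸ (k ∸ x)    ≡⟨ ∸-+-assoc k y (k ∸ x) ⟩
  k ∸ (y + (k ∸ x))  ≡⟨ cong (k ∸_) (+-comm y (k ∸ x)) ⟩
  k ∸ ((k ∸ x) + y)  ≡⟨ ∸-+-assoc k (k ∸ x) y ⟨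
  k ∸ (k ∸ x) ∸ y    ≡⟨ cong (_∸ y) (m∸[m∸n]≡n x≤k) ⟩
  x ∸ y              ∎
  where open ≡-Reasoning

-- Subtraction from `k` turns the maximum in `gain` into the minimum in `drop`; the bound on `w`
-- makes the truncated differences exact.
drop-complement : ∀ {n k} (v w : Vec ℕ n) → Bounded k w →
  drop (complement k v) (complement k w) ≡ sum (gain v w)
drop-complement     []      []       []        = refl
drop-complement {k = k} (x ∷ v) (x′ ∷ w) (x′≤k ∷ b) = cong₂ _+_
  (trans (cong (_∸ (k ∸ x′)) (cap w)) (∸-∸ (x ⊔ head₀ w) x′≤k)) (drop-complement v w b)
  where
  cap : ∀ {n} (w : Vec ℕ n) → (k ∸ x) ⊓ʰ complement k w ≡ k ∸ (x ⊔ head₀ w)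
  cap []      = cong (k ∸_) (sym (⊔-identityʳ x))
  cap (y ∷ _) = sym (∸-distribˡ-⊔-⊓ k x y)

edgeWeight-complement : ∀ {n m k} (v : Vec ℕ n) (R : Vec (Vec ℕ n) m) → VecAll.All (Bounded k) R →
  edgeWeight (complement k v) (Vec.map (complement k) R) ≡ columnWeight (gains v R)
edgeWeight-complement         v []      []       = refl
edgeWeight-complement {m = m} v (w ∷ R) (b ∷ bs) =
  cong₂ _+_ (cong (m *_) (drop-complement v w b)) (edgeWeight-complement w R bs)

chain-complement : ∀ {n m} k (v : Vec ℕ n) (R : Vec (Vec ℕ n) m) → Chain v R →
  EdgeChain (complement k v) (Vec.map (complement k) R)
chain-complement k v []      _       = tt
chain-complement k v (w ∷ R) (s , c) = step-complement k v w s , chain-complement k w R c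

complement-chain : ∀ {n m} k (v : Vec ℕ n) (R : Vec (Vec ℕ n) m) → EdgeChain v R →
  Chain (complement k v) (Vec.map (complement k) R)
complement-chain k v []      _       = tt
complement-chain k v (w ∷ R) (s , c) = complement-step k v w s , complement-chain k w R c

edgeChain-bounded : ∀ {n m k} {v : Vec ℕ n} (R : Vec (Vec ℕ n) m) → Bounded k v → EdgeChain v R →
  VecAll.All (Bounded k) R
edgeChain-bounded []      b _       = []
edgeChain-bounded (w ∷ R) b (s , c) = edgeStep-bounded b s ∷ edgeChain-bounded R (edgeStep-bounded b s) c

lastFrom-map : ∀ {n m} (f : Vec ℕ n → Vec ℕ n) v (R : Vec (Vec ℕ n) m) →
  lastFrom (f v) (Vec.map f R) ≡ f (lastFrom v R)
lastFrom-map f v []      = refl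
lastFrom-map f v (w ∷ R) = lastFrom-map f w R

zeros : ∀ n → Vec ℕ n
zeros n = Vec.replicate n 0

bounded-replicate : ∀ n {c k} → c ≤ k → Bounded k (Vec.replicate n c)
bounded-replicate zero    c≤k = []
bounded-replicate (suc n) c≤k = c≤k ∷ bounded-replicate n c≤k

complement-zeros : ∀ n k → complement k (zeros n) ≡ Vec.replicate n k
complement-zeros n k = Vec.map-replicate (k ∸_) 0 n

complement-full : ∀ n k → complement k (Vec.replicate n k) ≡ zeros n
complement-full n k = trans (Vec.map-replicate (k ∸_) k n) (cong (Vec.replicate n) (n∸n≡0 k))

columns-edges : ∀ {n} m k (V : Vec ℕ n → Set) → let K = Vec.replicate n k in
  Bijection (λ (R : Vec (Vec ℕ n) m) → Chain (zeros n) R × VecAll.All (Bounded k) R × V (complement k (lastFrom (zeros n) R)))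
            (λ (Es : Vec (Vec ℕ n) m) → EdgeChain K Es × V (lastFrom K Es))
            (columnWeight ∘ gains (zeros n)) (edgeWeight K)
columns-edges {n} m k V = record
  { to      = Vec.map (complement k)
  ; from    = Vec.map (complement k)
  ; to-∈    = λ {R} (c , b , v) →
      subst (λ u → EdgeChain u (Vec.map (complement k) R)) (complement-zeros n k) (chain-complement k (zeros n) R c) ,
      subst V (sym (last R)) v
  ; from-∈  = λ {Es} (ec , v) →
      subst (λ u → Chain u (Vec.map (complement k) Es)) (complement-full n k) (complement-chain k (Vec.replicate n k) Es ec) ,
      bounds Es ,
      subst V (trans (cong (lastFrom (Vec.replicate n k)) (sym (involutive Es ec))) (last (Vec.map (complement k) Es))) v
  ; from∘to = λ (_ , b , _) → complements-involutive b
  ; to∘from = λ {Es} (ec , _) → involutive Es ec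
  ; weight  = λ {R} (_ , b , _) → trans
      (cong (λ u → edgeWeight u (Vec.map (complement k) R)) (sym (complement-zeros n k)))
      (edgeWeight-complement (zeros n) R b)
  }
  where
  last : ∀ (R : Vec (Vec ℕ n) m) → lastFrom (Vec.replicate n k) (Vec.map (complement k) R) ≡ complement k (lastFrom (zeros n) R)
  last R = trans (cong (λ u → lastFrom u (Vec.map (complement k) R)) (sym (complement-zeros n k)))
                 (lastFrom-map (complement k) (zeros n) R)
  bounds : ∀ {m} (R : Vec (Vec ℕ n) m) → VecAll.All (Bounded k) (Vec.map (complement k) R)
  bounds []      = []
  bounds (w ∷ R) = complement-bounded k w ∷ bounds R
  involutive : ∀ Es → EdgeChain (Vec.replicate n k) Es → Vec.map (complement k) (Vec.map (complement k) Es) ≡ Es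
  involutive Es ec = complements-involutive (edgeChain-bounded Es (bounded-replicate n ≤-refl) ec)

-- Without a bound on the columns, the gains are arbitrary.
grow : ∀ {n} → Vec ℕ n → Vec ℕ n → Vec ℕ n
grow []      []      = []
grow (x ∷ v) (d ∷ e) = (x ⊔ head₀ (grow v e) + d) ∷ grow v e

grows : ∀ {n m} → Vec ℕ n → Vec (Vec ℕ n) m → Vec (Vec ℕ n) m
grows v []      = []
grows v (d ∷ D) = grow v d ∷ grows (grow v d) D

step-grow : ∀ {n} (v d : Vec ℕ n) → Step v (grow v d)
step-grow []      []      = tt
step-grow (x ∷ v) (d ∷ e) =
  ≤-trans (m≤m⊔n x _) (m≤m+n _ d) , ≤-trans (m≤n⊔m x _) (m≤m+n _ d) , step-grow v e

gain-grow : ∀ {n} (v d : Vec ℕ n) → gain v (grow v d) ≡ d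
gain-grow []      []      = refl
gain-grow (x ∷ v) (d ∷ e) = cong₂ _∷_ (m+n∸m≡n (x ⊔ head₀ (grow v e)) d) (gain-grow v e)

grow-gain : ∀ {n} (v w : Vec ℕ n) → Step v w → grow v (gain v w) ≡ w
grow-gain []      []       _           = refl
grow-gain (x ∷ v) (x′ ∷ w) (p , q , s) rewrite grow-gain v w s =
  cong (_∷ w) (m+[n∸m]≡n (⊔-lub p q))

chain-grows : ∀ {n m} (v : Vec ℕ n) (D : Vec (Vec ℕ n) m) → Chain v (grows v D)
chain-grows v []      = tt
chain-grows v (d ∷ D) = step-grow v d , chain-grows (grow v d) D

gains-grows : ∀ {n m} (v : Vec ℕ n) (D : Vec (Vec ℕ n) m) → gains v (grows v D) ≡ D
gains-grows v []      = refl
gains-grows v (d ∷ D) = cong₂ _∷_ (gain-grow v d) (gains-grows (grow v d) D)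

grows-gains : ∀ {n m} (v : Vec ℕ n) (R : Vec (Vec ℕ n) m) → Chain v R → grows v (gains v R) ≡ R
grows-gains v []      _       = refl
grows-gains v (w ∷ R) (s , c) = cong₂ _∷_ (grow-gain v w s)
  (trans (cong (λ u → grows u (gains w R)) (grow-gain v w s)) (grows-gains w R c))

columns-gains : ∀ n m → Bijection (Chain {n} {m} (zeros n)) (λ _ → ⊤) (columnWeight ∘ gains (zeros n)) columnWeight
columns-gains n m = record
  { to      = gains (zeros n)
  ; from    = grows (zeros n)
  ; to-∈    = λ _ → tt
  ; from-∈  = λ {D} _ → chain-grows (zeros n) D
  ; from∘to = λ {R} → grows-gains (zeros n) R
  ; to∘from = λ {D} _ → gains-grows (zeros n) D
  ; weight  = λ _ → refl
  }

vecWeight-∷ʳ : ∀ {X : Set} {m} (u : ℕ → X → ℕ) (xs : Vec X m) x →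
  vecWeight u (xs ∷ʳ x) ≡ u m x + vecWeight u xs
vecWeight-∷ʳ         u []       x = refl
vecWeight-∷ʳ {m = suc m} u (y ∷ xs) x =
  trans (cong (u 0 y +_) (vecWeight-∷ʳ (u ∘ suc) xs x)) (left-comm (u 0 y) (u (suc m) x) _)
  where
  left-comm : ∀ a b c → a + (b + c) ≡ b + (a + c)
  left-comm = solve-∀

-- Nested in this form it is literally the weight of the nested enumeration behind a product of
-- powers.
matrixWeight : ∀ {n m} → Vec (Vec ℕ n) m → ℕ
matrixWeight = vecWeight (λ l → vecWeight (λ _ → suc l *_))

vecWeight-* : ∀ {n} c (v : Vec ℕ n) → vecWeight (λ _ → c *_) v ≡ c * sum v
vecWeight-* c []      = sym (*-zeroʳ c)
vecWeight-* c (x ∷ v) = trans (cong (c * x +_) (vecWeight-* c v)) (sym (*-distribˡ-+ c x (sum v)))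

reverse-weight : ∀ {n m} (D : Vec (Vec ℕ n) m) → matrixWeight (Vec.reverse D) ≡ columnWeight D
reverse-weight []                  = refl
reverse-weight {m = suc m} (d ∷ D) = begin
  matrixWeight (Vec.reverse (d ∷ D))                           ≡⟨ cong matrixWeight (Vec.reverse-∷ d D) ⟩
  matrixWeight (Vec.reverse D ∷ʳ d)                            ≡⟨ vecWeight-∷ʳ (λ l → vecWeight (λ _ → suc l *_)) (Vec.reverse D) d ⟩
  vecWeight (λ _ → suc m *_) d + matrixWeight (Vec.reverse D)  ≡⟨ cong₂ _+_ (vecWeight-* (suc m) d) (reverse-weight D) ⟩
  suc m * sum d + columnWeight D                               ∎
  where open ≡-Reasoning

-- Columns are listed from the highest level down, the factors of the product from the first one up.
reverse-columns : ∀ n m → Bijection {Vec (Vec ℕ n) m} (λ _ → ⊤) (λ _ → ⊤) columnWeight matrixWeight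
reverse-columns n m = record
  { to      = Vec.reverse
  ; from    = Vec.reverse
  ; to-∈    = id
  ; from-∈  = id
  ; from∘to = λ {D} _ → Vec.reverse-involutive D
  ; to∘from = λ {D} _ → Vec.reverse-involutive D
  ; weight  = λ {D} _ → reverse-weight D
  }

-- Counting the fibers

lookup-injective : ∀ {A : Set} {xs : List A} → Unique xs → ∀ i j → lookup xs i ≡ lookup xs j → i ≡ j
lookup-injective (_  ∷ _) Fin.zero    Fin.zero    _  = refl
lookup-injective (x∉ ∷ _) Fin.zero    (Fin.suc j) eq = contradiction eq (All.lookup x∉ (∈-lookup j))
lookup-injective (x∉ ∷ _) (Fin.suc i) Fin.zero    eq = contradiction (sym eq) (All.lookup x∉ (∈-lookup i))
lookup-injective (_  ∷ u) (Fin.suc i) (Fin.suc j) eq = cong Fin.suc (lookup-injective u i j eq)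

module _ {n m : ℕ} {P : Pred PlanePartition 0ℓ} {Q : Vec (Vec ℕ n) m → Set}
         (P⊆PP∞ : ∀ {π} → P π → PP∞ n m π) (Q⊆Chain : ∀ {R} → Q R → Chain (zeros n) R)
         (encode-∈ : ∀ {π} → P π → Q (encode π)) (decode-∈P : ∀ {R} (v : Q R) → P (decode R (Q⊆Chain v)))
         {X : Set} {S : X → Set} {w : X → ℕ}
         (B : Bijection Q S (columnWeight ∘ gains (zeros n)) w) (E : Enumeration S w) where
  private
    module B = Bijection B

    -- The entries come from the columns alone; the chain enters only the proofs in `decode`.
    decode-cong : ∀ {R R′ : Vec (Vec ℕ n) m} → R ≡ R′ → (c : Chain (zeros n) R) (c′ : Chain (zeros n) R′) → decode R c ≗ₚ decode R′ c′
    decode-cong refl c c′ i j = refl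

    code : PlanePartition → X
    code π = B.to (encode π)

    code-∈ : ∀ {π d} → P π → cornerVolume π ≡ d → code π ∈ list E d
    code-∈ {π} p refl = subst (λ d → code π ∈ list E d)
      (trans (B.weight (encode-∈ p)) (encode-weight {m = m} {π = π} (P⊆PP∞ p))) (complete E (B.to-∈ (encode-∈ p)))

    module _ (d : ℕ) (i : Fin (length (list E d))) where
      x = lookup (list E d) i
      x∈ : S x × w x ≡ d
      x∈ = sound E (∈-lookup i)
      valid : Q (B.from x)
      valid = B.from-∈ (proj₁ x∈)
      partition : PlanePartition
      partition = decode (B.from x) (Q⊆Chain valid)
      encode-partition : encode partition ≡ B.from x
      encode-partition = encode-decode (B.from x) (Q⊆Chain valid)
      code-partition : code partition ≡ x
      code-partition = trans (cong B.to encode-partition) (B.to∘from (proj₁ x∈))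
      partition-∈ : P partition × cornerVolume partition ≡ d
      partition-∈ = decode-∈P valid , (begin
        cornerVolume partition                         ≡⟨ encode-weight {m = m} {π = partition} (P⊆PP∞ (decode-∈P valid)) ⟨
        columnWeight (gains (zeros n) (encode {m = m} partition)) ≡⟨ cong (columnWeight ∘ gains (zeros n)) encode-partition ⟩
        columnWeight (gains (zeros n) (B.from x))      ≡⟨ B.weight valid ⟨
        w (B.to (B.from x))                            ≡⟨ cong w (B.to∘from (proj₁ x∈)) ⟩
        w x                                            ≡⟨ proj₂ x∈ ⟩
        d                                              ∎)
        where open ≡-Reasoning

    index : ∀ d → Σ PlanePartition (λ π → P π × cornerVolume π ≡ d) → Fin (length (list E d))
    index d (π , p , v) = Any.index (code-∈ p v)

    lookup-index′ : ∀ d (π : Σ PlanePartition (λ π → P π × cornerVolume π ≡ d)) →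
      lookup (list E d) (index d π) ≡ code (proj₁ π)
    lookup-index′ d (π , p , v) = sym (lookup-index (code-∈ p v))

    -- A position is extracted from a membership proof, which depends on the proofs attached to the
    -- partition. As the list has no repetitions, the position depends only on the code, hence only
    -- on the array.
    index-cong : ∀ d π σ → proj₁ π ≗ₚ proj₁ σ → index d π ≡ index d σ
    index-cong d π σ π≗σ = lookup-injective (unique E d) _ _
      (trans (lookup-index′ d π)
        (trans (cong B.to (encode-cong (proj₁ π) (proj₁ σ) π≗σ)) (sym (lookup-index′ d σ))))

    index-partition : ∀ d i → index d (partition d i , partition-∈ d i) ≡ i
    index-partition d i = lookup-injective (unique E d) _ _
      (trans (lookup-index′ d (partition d i , partition-∈ d i)) (code-partition d i))

    partition-index : ∀ d π → partition d (index d π) ≗ₚ proj₁ π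
    partition-index d π̂@(π , p , v) i j = trans
      (decode-cong (trans (cong B.from (lookup-index′ d π̂)) (B.from∘to (encode-∈ p)))
                   (Q⊆Chain (valid d (index d π̂))) (Q⊆Chain (encode-∈ p)) i j)
      (decode-encode π (P⊆PP∞ p) (Q⊆Chain (encode-∈ p)) i j)

  fiber-counts : ∀ {F : PowerSeries} → Counts E F → ∑[π∈ P ]q^∣π∣c≈ F
  fiber-counts counts d = length (list E d) , record
    { to        = index d
    ; from      = λ i → partition d i , partition-∈ d i
    ; to-cong   = λ {π} {σ} → index-cong d π σ
    ; from-cong = λ { refl i j → refl }
    ; inverse   = (λ {i} {π} π≗ → trans (index-cong d π (partition d i , partition-∈ d i) π≗) (index-partition d i))
                , (λ { {π} refl → partition-index d π })
    } , counts d

-- The three generating functions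

bounded-columns : ∀ m n {k r} → (∀ i l → r i l ≤ k) → VecAll.All (Bounded k) (columns m n r)
bounded-columns zero    n r≤k = []
bounded-columns (suc m) n r≤k = bounded-tab n (λ i → r≤k i m) ∷ bounded-columns m n r≤k
  where
  bounded-tab : ∀ n {f k} → (∀ i → f i ≤ k) → Bounded k (tab n f)
  bounded-tab zero    f≤k = []
  bounded-tab (suc n) f≤k = f≤k 0 ∷ bounded-tab n (f≤k ∘ suc)

colAt-≤ : ∀ {m n k} (R : Vec (Vec ℕ n) m) → VecAll.All (Bounded k) R → ∀ i l → colAt R i l ≤ k
colAt-≤ []              []       i l = z≤n
colAt-≤ {suc m} (v ∷ R) (b ∷ bs) i l with l ≟ m
... | yes _ = at-≤ v b i
  where
  at-≤ : ∀ {n k} (v : Vec ℕ n) → Bounded k v → ∀ i → at v i ≤ k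
  at-≤ []      []        i       = z≤n
  at-≤ (x ∷ v) (x≤k ∷ b) zero    = x≤k
  at-≤ (x ∷ v) (x≤k ∷ b) (suc i) = at-≤ v b i
... | no _ = colAt-≤ R bs i l

-- With at least one column the last one has index 0. For levels it lists the numbers of positive
-- entries in the rows, that is, the shape.
lastFrom-columns : ∀ m n r v → lastFrom v (columns (suc m) n r) ≡ tab n (λ i → r i 0)
lastFrom-columns zero    n r v = refl
lastFrom-columns (suc m) n r v = lastFrom-columns m n r (tab n (λ i → r i (suc m)))

lastFrom-colAt : ∀ {m n} v (R : Vec (Vec ℕ n) (suc m)) → lastFrom v R ≡ tab n (λ i → colAt R i 0)
lastFrom-colAt {m} {n} v R = trans (cong (lastFrom v) (sym (columns-colAt R))) (lastFrom-columns m n (colAt R) v)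

complement-tab⁻ : ∀ n k {f} → complement k (tab n f) ≡ zeros n → ∀ i → i < n → k ≤ f i
complement-tab⁻ (suc n) k eq zero    _         = m∸n≡0⇒m≤n (cong Vec.head eq)
complement-tab⁻ (suc n) k eq (suc i) (s≤s i<n) = complement-tab⁻ n k (cong Vec.tail eq) i i<n

letter-powers : ∀ L m (i : Fin (L + m)) d →
  (ones L Vector.++ q-powers m) i d ≡ (q ⊛^ (suc (toℕ i) ∸ L)) d
letter-powers L m i d with splitAt L i in eq
... | inj₁ j = cong (λ a → (q ⊛^ a) d) (sym (m≤n⇒m∸n≡0 (subst (_< L) toℕ≡ (Fin.toℕ<n j))))
  where
  toℕ≡ : toℕ j ≡ toℕ i
  toℕ≡ = trans (sym (Fin.toℕ-↑ˡ j m)) (cong toℕ (Fin.splitAt⁻¹-↑ˡ eq))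
... | inj₂ j = cong (λ a → (q ⊛^ a) d) (sym (begin
  suc (toℕ i) ∸ L        ≡⟨ cong (λ a → suc a ∸ L) (trans (cong toℕ (sym (Fin.splitAt⁻¹-↑ʳ eq))) (Fin.toℕ-↑ʳ L j)) ⟩
  suc (L + toℕ j) ∸ L    ≡⟨ cong (_∸ L) (+-suc L (toℕ j)) ⟨
  L + suc (toℕ j) ∸ L    ≡⟨ m+n∸m≡n L (suc (toℕ j)) ⟩
  suc (toℕ j)            ∎))
  where open ≡-Reasoning

level-≤ : ∀ {k} π → ColumnsAtMost k π → ∀ i l → level π i l ≤ k
level-≤ {k} π cols i l = ≮⇒≥ λ k< → n≮0 (subst (l <_) (cols i k ≤-refl) (<-level⇒ π k<))

module _ {n L m′ : ℕ} (k : ℕ) {V : Vec ℕ n → Set} (base : Base n L V) where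
  private
    m = suc m′
    Q : Vec (Vec ℕ n) m → Set
    Q R = Chain (zeros n) R × VecAll.All (Bounded k) R × V (complement k (lastFrom (zeros n) R))

  schur-sum : {P : Pred PlanePartition 0ℓ} → (∀ {π} → P π → PP k n m π) →
    (∀ {π} → P π → V (complement k (lastFrom (zeros n) (encode {m = m} π)))) →
    (∀ {R} (q : Q R) → P (decode R (proj₁ q))) →
    ∑[π∈ P ]q^∣π∣c≈ s (List.replicate n k) (ones L Vector.++ q-powers m)
  schur-sum {P} P⊆PP encode-V decode-P = fiber-counts
    (λ p → proj₂ (P⊆PP p)) proj₁
    (λ {π} p → encode-chain {π = π} (proj₂ (P⊆PP p)) ,
               bounded-columns m n (level-≤ π (proj₁ (P⊆PP p))) , encode-V p)
    decode-P
    (columns-edges m k V ∙ (edges-rsk base k m ∙ (strips-tableau base k m ∙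
      -- The default letter of `tableau-filling` is the one with variable q, which exists since `m`
      -- is positive.
      tableau-filling (L ↑ʳ Fin.zero) L n k)))
    (enumerate-ssyt L (L + m) (List.replicate n k))
    (schur-counts L (List.replicate n k) (ones L Vector.++ q-powers m) (letter-powers L m))

decode-PP : ∀ {n m k} {R : Vec (Vec ℕ n) m} (c : Chain (zeros n) R) → VecAll.All (Bounded k) R → PP k n m (decode R c)
decode-PP {m = m} {R = R} c b =
  (λ i j k≤j → conjugate-≥ m (≤-trans (colAt-≤ R b i 0) k≤j)) , decode-∈ R c

module _ {k n m : ℕ} {π : PlanePartition} (π∈ : PP′ k n m π) where

  PP′⊆PP : PP k n m π
  PP′⊆PP =
    (λ i j k≤j → n≤0⇒n≡0 (≮⇒≥ λ 0<π → <⇒≱ (proj₂ (Equivalence.to (proj₁ π∈ i j) 0<π)) k≤j)) ,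
    (λ i j n≤i → n≤0⇒n≡0 (≮⇒≥ λ 0<π → <⇒≱ (proj₁ (Equivalence.to (proj₁ π∈ i j) 0<π)) n≤i)) ,
    proj₂ π∈

  level-PP′ : ∀ i → i < n → level π i 0 ≡ k
  level-PP′ i i<n = <-ext
    (λ c< → proj₂ (Equivalence.to (proj₁ π∈ i _) (<-level⇒ π c<)))
    (λ c<k → <-level π (Equivalence.from (proj₁ π∈ i _) (i<n , c<k)))

encode-PP′ : ∀ {k n m′ π} → PP′ k n (suc m′) π →
  complement k (lastFrom (zeros n) (encode {m = suc m′} π)) ≡ zeros n
encode-PP′ {k} {n} {m′} {π} π∈ = trans
  (cong (complement k) (trans (lastFrom-columns m′ n (level π) (zeros n)) (tab-constant n k (level-PP′ {π = π} π∈))))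
  (complement-full n k)

-- The vanishing complement gives at least `k` positive entries in each of the `n` rows, and the
-- bound on the columns gives at most `k`.
decode-PP′ : ∀ {k n m′} {R : Vec (Vec ℕ n) (suc m′)} (c : Chain (zeros n) R) → VecAll.All (Bounded k) R →
  complement k (lastFrom (zeros n) R) ≡ zeros n → PP′ k n (suc m′) (decode R c)
decode-PP′ {k} {n} {m′} {R} c b last = (λ i j → mk⇔ (inside i j) (positive i j)) , proj₂ (decode-∈ R c)
  where
  full : ∀ i → i < n → k ≤ colAt R i 0
  full = complement-tab⁻ n k (trans (cong (complement k) (sym (lastFrom-colAt (zeros n) R))) last)
  inside : ∀ i j → 0 < conjugate (suc m′) (colAt R i) j → i < n × j < k
  inside i j 0<π = ≰⇒> (λ n≤i → n≮0 (subst (j <_) (colAt-row-≥ R i 0 n≤i) j<)) ,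
                   <-≤-trans j< (colAt-≤ R b i 0)
    where
    j< : j < colAt R i 0
    j< = <-conjugate⇒ (suc m′) (colAt R i) 0<π
  positive : ∀ i j → i < n × j < k → 0 < conjugate (suc m′) (colAt R i) j
  positive i j (i<n , j<k) =
    <-conjugate (suc m′) (colAt-antitone R c i) (colAt-≥ R i) (<-≤-trans j<k (full i i<n))

product-sum : ∀ n m → ∑[π∈ PP∞ n m ]q^∣π∣c≈ product {m} (λ i → recip (1# ⊝ q ⊛^ suc (toℕ i)) ⊛^ n)
product-sum n m = fiber-counts id id (λ {π} → encode-chain {π = π}) (λ {R} c → decode-∈ R c)
  (columns-gains n m ∙ reverse-columns n m)
  (enumerate-vec m (λ l → enumerate-vec n (λ _ → enumerate-multiples l)))
  (product-counts m _ (λ l → power-counts n (enumerate-multiples l) (geometric-counts l)))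

open import Defs
open import Data.Vec.Functional using (_++_)

theorem6p8 : (k n m : ℕ) → 1 ≤ k → 1 ≤ n → 1 ≤ m →
    let ρ = replicate n k in
    (∑[π∈ PP k n m ]q^∣π∣c≈ s ρ (ones n ++ q-powers m))
    × (∑[π∈ PP′ k n m ]q^∣π∣c≈ s ρ (ones (n ∸ 1) ++ q-powers m))
    × (∑[π∈ PP∞ n m ]q^∣π∣c≈ product {m} (λ i → recip (1# - q ^ suc (toℕ i)) ^ n))
theorem6p8 k n@(suc n′) m@(suc m′) _ _ _ =
  schur-sum k (base-any n) id (λ _ → tt) (λ (c , b , _) → decode-PP c b) ,
  schur-sum k (base-zero n′) (λ {π} → PP′⊆PP {π = π}) (λ {π} → encode-PP′ {π = π})
    (λ (c , b , last) → decode-PP′ c b last) ,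
  product-sum n m
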